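{- Let $n\geq 3$. Then $$\det \tilde H_{K_{n}}={(-1)}^{\binom{n}{2}-1}{2}^{\binom{n}{2}-n+1}n^{n+\binom{n}{2}(n-4)}(n-2).$$ Hence the Hessian $\det H_{K_{n}}$ (a polynomial in the edge variables) is not identically zero for $n\geq 3$.
   Context: For a connected graph $\Gamma$ with edge set $E(\Gamma)$, assign a variable $x_e$ to each edge $e$. The Kirchhoff polynomial is $F_\Gamma=\sum_{T}\prod_{e\in E(T)}x_e$, the sum over all spanning trees $T$ of $\Gamma$. The Hessian matrix of $\Gamma$ is $H_\Gamma=\left(\frac{\partial^2 F_\Gamma}{\partial x_i\partial x_j}\right)_{i,j\in E(\Gamma)}$, and $\tilde H_\Gamma$ denotes $H_\Gamma$ evaluated at $x_e=1$ for all edges $e$. $K_n$ is the complete graph on $n$ vertices. -}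

module Defs where

open import Data.Nat as ℕ using (ℕ; zero; suc; _<_; _∸_)
open import Data.Nat.Combinatorics using (_C_)
open import Data.Integer as ℤ using (ℤ; +_)
open import Data.Fin using (Fin; zero; suc; punchIn; _≟_)
open import Data.Fin.Subset as Sub using (Subset; inside; outside)
import Data.Fin.Subset.Properties as SubP
open import Data.Fin.Subset using (_∈_; ∣_∣)
open import Data.Sum using (_⊎_)
open import Data.Product using (_×_; _,_; proj₁; proj₂)
open import Data.List using (List; []; _∷_; length; lookup; concatMap; map; foldr; allFin; filter)
open import Data.Vec using (_[_]≔_)
open import Data.Bool using (if_then_else_)
open import Relation.Nullary using (¬_; does)
open import Relation.Binary.PropositionalEquality using (_≡_)

sumFin : ∀ m → (Fin m → ℤ) → ℤ
sumFin zero    f = + 0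
sumFin (suc m) f = f zero ℤ.+ sumFin m (λ i → f (suc i))

prodFin : ∀ m → (Fin m → ℤ) → ℤ
prodFin zero    f = + 1
prodFin (suc m) f = f zero ℤ.* prodFin m (λ i → f (suc i))

det : ∀ m → (Fin m → Fin m → ℤ) → ℤ
det zero    M = + 1
det (suc m) M =
  sumFin (suc m) λ j →
    ((ℤ.- + 1) ℤ.^ Data.Fin.toℕ j) ℤ.* M zero j ℤ.*
      det m (λ r c → M (suc r) (punchIn j c))

edgesK : (n : ℕ) → List (Fin n × Fin n)
edgesK n = concatMap (λ i → map (i ,_) (filter (λ j → i Data.Fin.<? j) (allFin n))) (allFin n)

m : ℕ → ℕ
m n = length (edgesK n)

ends : (n : ℕ) → Fin (m n) → Fin n × Fin n
ends n e = lookup (edgesK n) e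

Adj : (n : ℕ) → Fin (m n) → Fin n → Fin n → Set
Adj n e u w = (ends n e ≡ (u , w)) ⊎ (ends n e ≡ (w , u))

data Reach (n : ℕ) (T : Subset (m n)) : Fin n → Fin n → Set where
  here : ∀ {u} → Reach n T u u
  step : ∀ {u w v} (e : Fin (m n)) → e ∈ T → Adj n e u w → Reach n T w v → Reach n T u v

Connected : (n : ℕ) → Subset (m n) → Set
Connected n T = ∀ u v → Reach n T u v

-- no cycles: no edge of T lies on a cycle, i.e. removing any edge e of T
-- leaves its endpoints disconnected
Acyclic : (n : ℕ) → Subset (m n) → Set
Acyclic n T = ∀ e → e ∈ T → ¬ Reach n (T [ e ]≔ outside) (proj₁ (ends n e)) (proj₂ (ends n e))

SpanningTree : (n : ℕ) → Subset (m n) → Set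
SpanningTree n T = Connected n T × Acyclic n T

-- Polynomials with integer coefficients in variables x_e, e : Fin k,
-- as formal sums of monomials  c · ∏_e x_e^(a e).

Poly : ℕ → Set
Poly k = List (ℤ × (Fin k → ℕ))

evalP : ∀ {k} → (Fin k → ℤ) → Poly k → ℤ
evalP {k} x = foldr (λ t acc → proj₁ t ℤ.* prodFin k (λ e → x e ℤ.^ proj₂ t e) ℤ.+ acc) (+ 0)

∂ : ∀ {k} → Fin k → Poly k → Poly k
∂ i = map (λ t → (proj₁ t ℤ.* + proj₂ t i , λ e → if does (e ≟ i) then proj₂ t e ∸ 1 else proj₂ t e))

ind : ∀ {k} → Subset k → Fin k → ℕ
ind T e = if does (e SubP.∈? T) then 1 else 0

-- Kirchhoff polynomial of K_n, given a list Ts of the spanning trees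
-- (each listed exactly once): F = Σ_T ∏_{e ∈ T} x_e
kirchhoff : (n : ℕ) → List (Subset (m n)) → Poly (m n)
kirchhoff n Ts = map (λ T → (+ 1 , ind T)) Ts

hessian : (n : ℕ) → List (Subset (m n)) → (Fin (m n) → ℤ) → Fin (m n) → Fin (m n) → ℤ
hessian n Ts x i j = evalP x (∂ i (∂ j (kirchhoff n Ts)))

hessian1 : (n : ℕ) → List (Subset (m n)) → Fin (m n) → Fin (m n) → ℤ
hessian1 n Ts = hessian n Ts (λ _ → + 1)

{-# OPTIONS --safe #-}

-- A forest of K_n with components of sizes a₁, …, a_k lies in n^(k-2) a₁ ⋯ a_k spanning trees: by induction
-- on k, since (k - 1) times the number of such trees is the sum, over the edges f joining two components,
-- of the number of trees containing the forest and f.  Hence two edges lie together in n^(n-4) (4 - |e ∩ f|)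
-- trees, and the Hessian at the all-ones point is n^(n-4) (4 J - 2 I - Nᵀ N) with N the vertex-edge incidence
-- matrix.  That determinant is computed by starting from -2 I and subtracting the squares of the rows of N
-- one vertex at a time, then adding 4 J; each step is a rank-one update u vᵀ of a matrix A for which a
-- solution w of A w = d u is known, so the determinant changes by the factor (d - v · w) / d.
module Submission where

open import Defs
open import Data.Bool using (if_then_else_; true; false)
open import Data.Empty using (⊥-elim)
open import Data.Fin as Fin using (Fin; zero; suc; punchIn; _≟_; punchOut; toℕ; fromℕ<; inject₁)
open import Data.Fin.Induction using (<-weakInduction)
open import Data.Fin.Properties as Finₚ using (suc-injective; punchIn-punchOut; punchInᵢ≢i; punchIn-injective; toℕ-fromℕ<; toℕ-injective; toℕ<n; punchOut-punchIn; punchOut-cong)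
open import Data.Fin.Subset as Subsets using (Subset)
open import Data.Fin.Subset.Properties using (_∈?_; _⊆?_; ∉⊥; ⊆-antisym; ⊥⊆)
open import Data.Integer as ℤ using (ℤ; +_; -_)
open import Data.Integer.Properties using (+-identityˡ; +-identityʳ; *-identityˡ; *-identityʳ; *-zeroˡ; *-zeroʳ; *-comm; *-cancelˡ-≡; +-assoc; ^-distribˡ-+-*; ^-*-assoc; ^-zeroˡ; i*j≡0⇒i≡0∨j≡0; i^n≡0⇒i≡0; +-injective)
open import Data.Integer.Tactic.RingSolver using (solve-∀)
open import Data.List using (List; []; _∷_; _++_; length; lookup; concatMap; map; tabulate; filter; allFin)
import Data.List.Membership.Propositional as List
open import Data.List.Membership.Propositional.Properties using (∈-lookup; ∈-map⁻; ∈-filter⁻; ∈-concatMap⁻)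
import Data.List.Relation.Unary.All as All
import Data.List.Relation.Unary.All.Properties as Allₚ
open import Data.List.Relation.Unary.AllPairs as AllPairs using ([]; _∷_)
import Data.List.Relation.Unary.AllPairs.Properties as AllPairsₚ
open import Data.List.Relation.Unary.Any using (satisfied; index)
open import Data.List.Relation.Unary.Any.Properties using (lookup-index)
open import Data.List.Relation.Unary.Unique.Propositional using (Unique)
import Data.List.Relation.Unary.Unique.Propositional.Properties as Uniqueₚ
open import Data.Nat as ℕ using (ℕ; zero; suc; z≤n; s≤s)
open import Data.Nat.Combinatorics using (_C_; nC1≡n; nCk+nC[k+1]≡[n+1]C[k+1])
import Data.Nat.Properties as ℕₚ
open import Data.Product using (_×_; _,_; proj₁; proj₂; ∃₂; ∃)
open import Data.Sum using (_⊎_; inj₁; inj₂; [_,_]′)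
open import Data.Vec using (_[_]≔_)
open import Data.Vec.Properties using ([]≔-updates; []≔-minimal; lookup⇒[]=; []=⇒lookup; lookup∘update; lookup∘update′)
open import Function.Bundles using (_⇔_; Equivalence)
open import Relation.Binary.Definitions using (tri<; tri≈; tri>)
open import Relation.Binary.PropositionalEquality using (_≡_; _≢_; refl; sym; trans; cong; cong₂; module ≡-Reasoning; subst)
open import Relation.Nullary using (¬_; Dec; yes; no; does)
open import Relation.Nullary.Decidable using (dec-true; dec-false; ¬?)
open import Relation.Unary using (Pred; Decidable)
open ≡-Reasoning

-- Everything stays in ℤ, so quotients are cleared and cancelled at the end: at n = 3 the power
-- n^(n-4) is not an integer, hence the factor n² in `count-forest` and `hessian1-entry`, and the
-- factor d in front of each determinant update. The tree count closes because joining components of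
-- sizes a and b replaces the factor a b of the product by a + b, while a b edges join them; the sum
-- over all pairs then depends on the total size n alone. Vertices can be treated one at a time
-- because N Nᵀ = (n - 2) I + J gives the inner products of any set of rows: after k vertices, w
-- lies in the span of the next row and the sum of the earlier rows, and the factors n (n + k + 1) /
-- (2 (n + k)) telescope. The entry formula includes the diagonal, where 4 - 2 - 2 = 0 agrees with
-- the vanishing second derivative of a multilinear polynomial, so one matrix describes the whole
-- Hessian. The determinant is a first-row expansion, so its alternation in columns is derived from
-- adjacent columns; the rank-one update uses only operations between the first column of a bordered
-- matrix and the others.

module Summation where

  -- Finite sums, finite products and Iverson brackets.

  open import Data.Integer using (_+_; _*_; _-_; ≢-nonZero)

  +-congˡ : ∀ a {b c} → b ≡ c → a + b ≡ a + c
  +-congˡ a = cong (λ z → a + z)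

  +-moveʳ : ∀ {a b c} → a + b ≡ c → a ≡ c - b
  +-moveʳ {a} {b} h = trans (lemma a b) (cong (_- b) h)
    where
    lemma : ∀ a b → a ≡ a + b - b
    lemma = solve-∀

  cancelˡ : ∀ a {b c} → a ≢ + 0 → a * b ≡ a * c → b ≡ c
  cancelˡ a {b} {c} a≢0 = *-cancelˡ-≡ a b c {{≢-nonZero a≢0}}

  -- The Iverson bracket, through which case distinctions on vertices, labels and membership enter
  -- the sums; `⟦ i ≟ j ⟧` is the Kronecker delta.
  ⟦_⟧ : {P : Set} → Dec P → ℤ
  ⟦ d ⟧ = if does d then + 1 else + 0

  ⟦⟧-yes : {P : Set} (d : Dec P) → P → ⟦ d ⟧ ≡ + 1
  ⟦⟧-yes (yes _) p = refl
  ⟦⟧-yes (no ¬p) p = ⊥-elim (¬p p)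

  ⟦⟧-no : {P : Set} (d : Dec P) → ¬ P → ⟦ d ⟧ ≡ + 0
  ⟦⟧-no (yes p) ¬p = ⊥-elim (¬p p)
  ⟦⟧-no (no _)  ¬p = refl

  ⟦⟧-⇔ : {P Q : Set} (d : Dec P) (d′ : Dec Q) → (P → Q) → (Q → P) → ⟦ d ⟧ ≡ ⟦ d′ ⟧
  ⟦⟧-⇔ (yes p) d′ f g = sym (⟦⟧-yes d′ (f p))
  ⟦⟧-⇔ (no ¬p) d′ f g = sym (⟦⟧-no d′ (λ q → ¬p (g q)))

  -- When `P` fails both sides are zero, so the second factor may be rewritten under the assumption
  -- `P`.
  ⟦⟧-*-cong : {P : Set} (d : Dec P) {x y : ℤ} → (P → x ≡ y) → ⟦ d ⟧ * x ≡ ⟦ d ⟧ * y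
  ⟦⟧-*-cong (yes p) h = cong (+ 1 *_) (h p)
  ⟦⟧-*-cong (no _)  h = refl

  ⟦⟧-×-cong : {P Q R : Set} (p : Dec P) (q : Dec Q) (r : Dec R) →
    (P → Q → R) → (R → P) → (R → Q) → ⟦ p ⟧ * ⟦ q ⟧ ≡ ⟦ r ⟧
  ⟦⟧-×-cong (yes p) (yes q) r f g h = sym (⟦⟧-yes r (f p q))
  ⟦⟧-×-cong (yes p) (no ¬q) r f g h = sym (⟦⟧-no r (λ x → ¬q (h x)))
  ⟦⟧-×-cong (no ¬p) q       r f g h = trans (*-zeroˡ ⟦ q ⟧) (sym (⟦⟧-no r (λ x → ¬p (g x))))

  ⟦⟧-idem : {P : Set} (d : Dec P) → ⟦ d ⟧ * ⟦ d ⟧ ≡ ⟦ d ⟧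
  ⟦⟧-idem (yes _) = refl
  ⟦⟧-idem (no _)  = refl

  δ-sym : ∀ {n} (i j : Fin n) → ⟦ i ≟ j ⟧ ≡ ⟦ j ≟ i ⟧
  δ-sym i j = ⟦⟧-⇔ (i ≟ j) (j ≟ i) sym sym

  sum-cong : ∀ n {f g : Fin n → ℤ} → (∀ i → f i ≡ g i) → sumFin n f ≡ sumFin n g
  sum-cong zero    h = refl
  sum-cong (suc n) h = cong₂ _+_ (h zero) (sum-cong n (λ i → h (suc i)))

  sum-zero : ∀ n {f : Fin n → ℤ} → (∀ i → f i ≡ + 0) → sumFin n f ≡ + 0
  sum-zero zero    h = refl
  sum-zero (suc n) h = cong₂ _+_ (h zero) (sum-zero n (λ i → h (suc i)))

  sum-+ : ∀ n (f g : Fin n → ℤ) → sumFin n (λ i → f i + g i) ≡ sumFin n f + sumFin n g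
  sum-+ zero    f g = refl
  sum-+ (suc n) f g = trans (+-congˡ (f zero + g zero) (sum-+ n (λ i → f (suc i)) (λ i → g (suc i))))
    (lemma (f zero) (g zero) (sumFin n (λ i → f (suc i))) (sumFin n (λ i → g (suc i))))
    where
    lemma : ∀ a b c d → (a + b) + (c + d) ≡ (a + c) + (b + d)
    lemma = solve-∀

  sum-*ˡ : ∀ n a (f : Fin n → ℤ) → sumFin n (λ i → a * f i) ≡ a * sumFin n f
  sum-*ˡ zero    a f = sym (*-zeroʳ a)
  sum-*ˡ (suc n) a f = trans (+-congˡ (a * f zero) (sum-*ˡ n a (λ i → f (suc i))))
    (lemma a (f zero) (sumFin n (λ i → f (suc i))))
    where
    lemma : ∀ a b c → a * b + a * c ≡ a * (b + c)
    lemma = solve-∀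

  sum-*ʳ : ∀ n (f : Fin n → ℤ) a → sumFin n (λ i → f i * a) ≡ sumFin n f * a
  sum-*ʳ n f a = trans (sum-cong n (λ i → *-comm (f i) a)) (trans (sum-*ˡ n a f) (*-comm a _))

  sum-linear : ∀ n a b (f g : Fin n → ℤ) →
    sumFin n (λ i → a * f i + b * g i) ≡ a * sumFin n f + b * sumFin n g
  sum-linear n a b f g = trans (sum-+ n (λ i → a * f i) (λ i → b * g i)) (cong₂ _+_ (sum-*ˡ n a f) (sum-*ˡ n b g))

  sum-const : ∀ n a → sumFin n (λ _ → a) ≡ + n * a
  sum-const zero    a = sym (*-zeroˡ a)
  sum-const (suc n) a = trans (+-congˡ a (sum-const n a)) (lemma a (+ n))
    where
    lemma : ∀ a x → a + x * a ≡ (+ 1 + x) * a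
    lemma = solve-∀

  sum-swap : ∀ n k (f : Fin n → Fin k → ℤ) →
    sumFin n (λ i → sumFin k (f i)) ≡ sumFin k (λ j → sumFin n (λ i → f i j))
  sum-swap zero    k f = sym (sum-zero k (λ _ → refl))
  sum-swap (suc n) k f = trans (+-congˡ (sumFin k (f zero)) (sum-swap n k (λ i → f (suc i))))
    (sym (sum-+ k (f zero) (λ j → sumFin n (λ i → f (suc i) j))))

  sum-punchIn : ∀ n (i : Fin (suc n)) (f : Fin (suc n) → ℤ) →
    sumFin (suc n) f ≡ f i + sumFin n (λ j → f (punchIn i j))
  sum-punchIn n       zero    f = refl
  sum-punchIn (suc n) (suc i) f =
    trans (+-congˡ (f zero) (sum-punchIn n i (λ j → f (suc j))))
      (lemma (f zero) (f (suc i)) (sumFin n (λ j → f (suc (punchIn i j)))))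
    where
    lemma : ∀ a b c → a + (b + c) ≡ b + (a + c)
    lemma = solve-∀

  prod-punchIn : ∀ n (i : Fin (suc n)) (f : Fin (suc n) → ℤ) →
    prodFin (suc n) f ≡ f i * prodFin n (λ j → f (punchIn i j))
  prod-punchIn n       zero    f = refl
  prod-punchIn (suc n) (suc i) f =
    trans (cong (f zero *_) (prod-punchIn n i (λ j → f (suc j))))
      (lemma (f zero) (f (suc i)) (prodFin n (λ j → f (suc (punchIn i j)))))
    where
    lemma : ∀ a b c → a * (b * c) ≡ b * (a * c)
    lemma = solve-∀

  prod-cong : ∀ n {f g : Fin n → ℤ} → (∀ i → f i ≡ g i) → prodFin n f ≡ prodFin n g
  prod-cong zero    h = refl
  prod-cong (suc n) h = cong₂ _*_ (h zero) (prod-cong n (λ i → h (suc i)))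

  prod-one : ∀ n {f : Fin n → ℤ} → (∀ i → f i ≡ + 1) → prodFin n f ≡ + 1
  prod-one zero    h = refl
  prod-one (suc n) h = cong₂ _*_ (h zero) (prod-one n (λ i → h (suc i)))

  sum-δ : ∀ n (i : Fin n) (f : Fin n → ℤ) → sumFin n (λ j → ⟦ i ≟ j ⟧ * f j) ≡ f i
  sum-δ (suc n) zero f = begin
    + 1 * f zero + sumFin n (λ j → + 0 * f (suc j)) ≡⟨ +-congˡ (+ 1 * f zero) (sum-zero n (λ j → *-zeroˡ (f (suc j)))) ⟩
    + 1 * f zero + + 0                              ≡⟨ trans (+-identityʳ _) (*-identityˡ _) ⟩
    f zero                                          ∎
  sum-δ (suc n) (suc i) f = begin
    + 0 * f zero + sumFin n (λ j → ⟦ suc i ≟ suc j ⟧ * f (suc j)) ≡⟨ cong₂ _+_ (*-zeroˡ (f zero)) (sum-cong n (λ j → cong (_* f (suc j)) (⟦⟧-⇔ (suc i ≟ suc j) (i ≟ j) suc-injective (cong suc)))) ⟩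
    + 0 + sumFin n (λ j → ⟦ i ≟ j ⟧ * f (suc j))                  ≡⟨ +-identityˡ _ ⟩
    sumFin n (λ j → ⟦ i ≟ j ⟧ * f (suc j))                        ≡⟨ sum-δ n i (λ j → f (suc j)) ⟩
    f (suc i)                                                     ∎

  sum-δ-one : ∀ n (i : Fin n) → sumFin n (λ j → ⟦ i ≟ j ⟧) ≡ + 1
  sum-δ-one n i = trans (sum-cong n (λ j → sym (*-identityʳ _))) (sum-δ n i (λ _ → + 1))

-- Column operations and rank-one updates for determinants over ℤ.

module Determinants where
  open Summation
  open import Data.Integer using (_+_; _*_; _^_)

  Matrix : ℕ → Set
  Matrix n = Fin n → Fin n → ℤ

  minor : ∀ {n} → Matrix (suc n) → Fin (suc n) → Matrix n
  minor M j r c = M (suc r) (punchIn j c)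

  sign : ∀ {n} → Fin n → ℤ
  sign j = (- + 1) ^ toℕ j

  det-cong : ∀ n {M M′ : Matrix n} → (∀ r c → M r c ≡ M′ r c) → det n M ≡ det n M′
  det-cong zero    h = refl
  det-cong (suc n) h = sum-cong (suc n) λ j →
    cong₂ _*_ (cong (sign j *_) (h zero j)) (det-cong n (λ r c → h (suc r) (punchIn j c)))

  -- In the first-row expansion the term of column j is linear in its entry and its minor omits the
  -- column; every other term keeps the entry, and its minor contains the column at position
  -- `punchOut k≢j`, where induction applies.
  det-linear : ∀ n (j : Fin n) a b {M A B : Matrix n} →
    (∀ r → M r j ≡ a * A r j + b * B r j) →
    (∀ r c → c ≢ j → M r c ≡ A r c) → (∀ r c → c ≢ j → M r c ≡ B r c) →
    det n M ≡ a * det n A + b * det n B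
  det-linear (suc n) j a b {M} {A} {B} hj hA hB =
    trans (sum-cong (suc n) term) (sum-linear (suc n) a b
      (λ k → sign k * A zero k * det n (minor A k)) (λ k → sign k * B zero k * det n (minor B k)))
    where
    expand : ∀ s x y D → s * (a * x + b * y) * D ≡ a * (s * x * D) + b * (s * y * D)
    expand = lemma a b
      where
      lemma : ∀ a b s x y D → s * (a * x + b * y) * D ≡ a * (s * x * D) + b * (s * y * D)
      lemma = solve-∀
    expand′ : ∀ s x D D′ → s * x * (a * D + b * D′) ≡ a * (s * x * D) + b * (s * x * D′)
    expand′ = lemma a b
      where
      lemma : ∀ a b s x D D′ → s * x * (a * D + b * D′) ≡ a * (s * x * D) + b * (s * x * D′)
      lemma = solve-∀
    term : ∀ k → sign k * M zero k * det n (minor M k) ≡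
      a * (sign k * A zero k * det n (minor A k)) + b * (sign k * B zero k * det n (minor B k))
    term k with k ≟ j
    ... | yes refl = begin
      sign k * M zero k * det n (minor M k)                             ≡⟨ cong (λ x → sign k * x * det n (minor M k)) (hj zero) ⟩
      sign k * (a * A zero k + b * B zero k) * det n (minor M k)        ≡⟨ expand (sign k) (A zero k) (B zero k) (det n (minor M k)) ⟩
      a * (sign k * A zero k * det n (minor M k)) + b * (sign k * B zero k * det n (minor M k))
        ≡⟨ cong₂ (λ x y → a * (sign k * A zero k * x) + b * (sign k * B zero k * y))
             (det-cong n (λ r c → hA (suc r) (punchIn k c) (punchInᵢ≢i k c)))
             (det-cong n (λ r c → hB (suc r) (punchIn k c) (punchInᵢ≢i k c))) ⟩
      a * (sign k * A zero k * det n (minor A k)) + b * (sign k * B zero k * det n (minor B k)) ∎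
    ... | no k≢j = begin
      sign k * M zero k * det n (minor M k)
        ≡⟨ cong (sign k * M zero k *_) (det-linear n j′ a b hj′
             (λ r c c≢j′ → hA (suc r) (punchIn k c) (off c c≢j′)) (λ r c c≢j′ → hB (suc r) (punchIn k c) (off c c≢j′))) ⟩
      sign k * M zero k * (a * det n (minor A k) + b * det n (minor B k))
        ≡⟨ expand′ (sign k) (M zero k) (det n (minor A k)) (det n (minor B k)) ⟩
      a * (sign k * M zero k * det n (minor A k)) + b * (sign k * M zero k * det n (minor B k))
        ≡⟨ cong₂ (λ x y → a * (sign k * x * det n (minor A k)) + b * (sign k * y * det n (minor B k)))
             (hA zero k k≢j) (hB zero k k≢j) ⟩
      a * (sign k * A zero k * det n (minor A k)) + b * (sign k * B zero k * det n (minor B k)) ∎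
      where
      j′ = punchOut k≢j
      at : punchIn k j′ ≡ j
      at = punchIn-punchOut k≢j
      hj′ : ∀ r → minor M k r j′ ≡ a * minor A k r j′ + b * minor B k r j′
      hj′ r = subst (λ i → M (suc r) i ≡ a * A (suc r) i + b * B (suc r) i) (sym at) (hj (suc r))
      off : ∀ c → c ≢ j′ → punchIn k c ≢ j
      off c c≢j′ e = c≢j′ (punchIn-injective k c j′ (trans e (sym at)))

  det-zero-column : ∀ n (j : Fin n) (M : Matrix n) → (∀ r → M r j ≡ + 0) → det n M ≡ + 0
  det-zero-column n j M h = trans (det-linear n j (+ 0) (+ 0) {M} {M} {M} (λ r → trans (h r) (sym (vanish (M r j) (M r j)))) (λ _ _ _ → refl) (λ _ _ _ → refl)) (vanish (det n M) (det n M))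
    where
    vanish : ∀ x y → + 0 * x + + 0 * y ≡ + 0
    vanish = solve-∀

  infix 4 _⋖_
  -- Adjacency of columns as a family that recurses in step with `punchIn`, so that its behaviour
  -- under the deletion of a column follows by pattern matching.
  data _⋖_ : ∀ {n} → Fin n → Fin n → Set where
    zero⋖ : ∀ {n} → _⋖_ {suc (suc n)} zero (suc zero)
    suc⋖  : ∀ {n} {i j : Fin n} → i ⋖ j → suc i ⋖ suc j

  inject₁⋖suc : ∀ {n} (i : Fin n) → inject₁ i ⋖ suc i
  inject₁⋖suc zero    = zero⋖
  inject₁⋖suc (suc i) = suc⋖ (inject₁⋖suc i)

  ⋖⇒toℕ : ∀ {n} {i j : Fin n} → i ⋖ j → toℕ j ≡ suc (toℕ i)
  ⋖⇒toℕ zero⋖    = refl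
  ⋖⇒toℕ (suc⋖ p) = cong suc (⋖⇒toℕ p)

  ⋖⇒≢ : ∀ {n} {i j : Fin n} → i ⋖ j → i ≢ j
  ⋖⇒≢ (suc⋖ p) refl = ⋖⇒≢ p refl

  -- Deleting either of two adjacent columns leaves the same list of columns, except that one
  -- position holds the other of the two. Hence the two minors agree as soon as the two columns do.
  punchIn-⋖ : ∀ {n} {i j : Fin (suc n)} → i ⋖ j → ∀ c →
    punchIn i c ≡ punchIn j c ⊎ (punchIn i c ≡ j × punchIn j c ≡ i)
  punchIn-⋖ zero⋖            zero    = inj₂ (refl , refl)
  punchIn-⋖ zero⋖            (suc c) = inj₁ refl
  punchIn-⋖ {suc n} (suc⋖ p) zero    = inj₁ refl
  punchIn-⋖ {suc n} (suc⋖ p) (suc c) with punchIn-⋖ p c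
  ... | inj₁ e         = inj₁ (cong suc e)
  ... | inj₂ (e₁ , e₂) = inj₂ (cong suc e₁ , cong suc e₂)

  -- Deleting a third column cannot separate two neighbours, so the minor still has equal adjacent
  -- columns and the induction hypothesis reaches it.
  ⋖-punchIn⁻¹ : ∀ {n} {i j : Fin (suc n)} → i ⋖ j → ∀ k → k ≢ i → k ≢ j →
    ∃₂ λ i′ j′ → (i′ ⋖ j′) × (punchIn k i′ ≡ i) × (punchIn k j′ ≡ j)
  ⋖-punchIn⁻¹ zero⋖    zero          k≢i k≢j = ⊥-elim (k≢i refl)
  ⋖-punchIn⁻¹ zero⋖    (suc zero)    k≢i k≢j = ⊥-elim (k≢j refl)
  ⋖-punchIn⁻¹ {suc (suc n)} zero⋖ (suc (suc k)) k≢i k≢j = zero , suc zero , zero⋖ , refl , refl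
  ⋖-punchIn⁻¹ (suc⋖ p) zero          k≢i k≢j = _ , _ , p , refl , refl
  ⋖-punchIn⁻¹ {suc n} (suc⋖ p) (suc k) k≢i k≢j
    with ⋖-punchIn⁻¹ p k (λ e → k≢i (cong suc e)) (λ e → k≢j (cong suc e))
  ... | i′ , j′ , q , e₁ , e₂ = suc i′ , suc j′ , suc⋖ q , cong suc e₁ , cong suc e₂

  -- The terms of columns i and j have equal entries and equal minors but opposite signs, because
  -- the positions differ by one. Every other minor still contains both columns and vanishes by
  -- induction.
  det-equal-adjacent : ∀ n {i j : Fin n} → i ⋖ j → (M : Matrix n) → (∀ r → M r i ≡ M r j) → det n M ≡ + 0
  det-equal-adjacent (suc zero) (suc⋖ ())
  det-equal-adjacent (suc (suc n)) {i} {j} i⋖j M h = begin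
    sumFin (2 ℕ.+ n) t                                               ≡⟨ sum-punchIn (suc n) i t ⟩
    t i + sumFin (suc n) (λ l → t (punchIn i l))                     ≡⟨ +-congˡ (t i) (sum-punchIn n j′ (λ l → t (punchIn i l))) ⟩
    t i + (t (punchIn i j′) + sumFin n (λ l → t (punchIn i (punchIn j′ l))))
      ≡⟨ cong₂ (λ x y → t i + (x + y)) (cong t at) (sum-zero n (λ l → rest (det-equal-adjacent (suc n)) (punchIn i (punchIn j′ l)) (punchInᵢ≢i i (punchIn j′ l)) (λ e → punchInᵢ≢i j′ l (punchIn-injective i (punchIn j′ l) j′ (trans e (sym at)))))) ⟩
    t i + (t j + + 0)                                                ≡⟨ cong₂ (λ s D → t i + (s * M zero j * D + + 0)) (cong ((- + 1) ^_) (⋖⇒toℕ i⋖j)) (det-cong (suc n) same) ⟩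
    sign i * M zero i * D + (- + 1 * sign i * M zero j * D + + 0)    ≡⟨ cong (λ x → sign i * x * D + (- + 1 * sign i * M zero j * D + + 0)) (h zero) ⟩
    sign i * M zero j * D + (- + 1 * sign i * M zero j * D + + 0)    ≡⟨ cancel (sign i) (M zero j) D ⟩
    + 0                                                              ∎
    where
    t : Fin (2 ℕ.+ n) → ℤ
    t k = sign k * M zero k * det (suc n) (minor M k)
    D = det (suc n) (minor M i)
    j′ = punchOut (⋖⇒≢ i⋖j)
    at : punchIn i j′ ≡ j
    at = punchIn-punchOut (⋖⇒≢ i⋖j)
    cancel : ∀ s x D → s * x * D + (- + 1 * s * x * D + + 0) ≡ + 0
    cancel = solve-∀
    same : ∀ r c → minor M j r c ≡ minor M i r c
    same r c with punchIn-⋖ i⋖j c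
    ... | inj₁ e         = cong (M (suc r)) (sym e)
    ... | inj₂ (e₁ , e₂) = trans (cong (M (suc r)) e₂) (trans (h (suc r)) (cong (M (suc r)) (sym e₁)))
    rest : (∀ {i j} → i ⋖ j → (M : Matrix (suc n)) → (∀ r → M r i ≡ M r j) → det (suc n) M ≡ + 0) →
      ∀ k → k ≢ i → k ≢ j → t k ≡ + 0
    rest ih k k≢i k≢j with ⋖-punchIn⁻¹ i⋖j k k≢i k≢j
    ... | i′ , j″ , q , e₁ , e₂ = trans
      (cong (sign k * M zero k *_) (ih q (minor M k)
        (λ r → trans (cong (M (suc r)) e₁) (trans (h (suc r)) (cong (M (suc r)) (sym e₂))))))
      (*-zeroʳ (sign k * M zero k))

  replaceColumns : ∀ {n} → Fin n → Fin n → (Fin n → ℤ) → (Fin n → ℤ) → Matrix n → Matrix n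
  replaceColumns i j x y M r c = if does (c ≟ i) then x r else if does (c ≟ j) then y r else M r c

  module _ {n} (i j : Fin n) (i≢j : i ≢ j) (x y : Fin n → ℤ) (M : Matrix n) where

    replaceColumns-first : ∀ r → replaceColumns i j x y M r i ≡ x r
    replaceColumns-first r rewrite dec-true (i ≟ i) refl = refl

    replaceColumns-second : ∀ r → replaceColumns i j x y M r j ≡ y r
    replaceColumns-second r rewrite dec-false (j ≟ i) (λ e → i≢j (sym e)) | dec-true (j ≟ j) refl = refl

    replaceColumns-other : ∀ r c → c ≢ i → c ≢ j → replaceColumns i j x y M r c ≡ M r c
    replaceColumns-other r c c≢i c≢j rewrite dec-false (c ≟ i) c≢i | dec-false (c ≟ j) c≢j = refl

  -- Polarisation: as a function `D` of the two columns the determinant is bilinear and zero on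
  -- equal arguments, and expanding `D s s` for the sum `s` of the columns leaves `D x y` + `D y x`
  -- = 0.
  det-swap-adjacent : ∀ n {i j : Fin n} → i ⋖ j → (M M′ : Matrix n) →
    (∀ r → M′ r i ≡ M r j) → (∀ r → M′ r j ≡ M r i) → (∀ r c → c ≢ i → c ≢ j → M′ r c ≡ M r c) →
    det n M′ ≡ - det n M
  det-swap-adjacent n {i} {j} i⋖j M M′ hi hj hc =
    trans (sym (det-cong n M′-cols)) (trans (negate (D x y) (D y x) expansion) (cong -_ (det-cong n M-cols)))
    where
    i≢j = ⋖⇒≢ i⋖j
    x y : Fin n → ℤ
    x r = M r i
    y r = M r j
    R : (Fin n → ℤ) → (Fin n → ℤ) → Matrix n
    R x y = replaceColumns i j x y M
    D : (Fin n → ℤ) → (Fin n → ℤ) → ℤ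
    D x y = det n (R x y)
    s : Fin n → ℤ
    s r = x r + y r
    one : ∀ a b → a + b ≡ + 1 * a + + 1 * b
    one = solve-∀
    one′ : ∀ a b → + 1 * a + + 1 * b ≡ a + b
    one′ = solve-∀
    M-cols : ∀ r c → R x y r c ≡ M r c
    M-cols r c with c ≟ i
    ... | yes refl = refl
    ... | no _ with c ≟ j
    ...   | yes refl = refl
    ...   | no _     = refl
    M′-cols : ∀ r c → R y x r c ≡ M′ r c
    M′-cols r c with c ≟ i
    ... | yes refl = sym (hi r)
    ... | no c≢i with c ≟ j
    ...   | yes refl = sym (hj r)
    ...   | no c≢j   = sym (hc r c c≢i c≢j)
    vanish : ∀ z → D z z ≡ + 0
    vanish z = det-equal-adjacent n i⋖j (R z z)
      (λ r → trans (replaceColumns-first i j i≢j z z M r) (sym (replaceColumns-second i j i≢j z z M r)))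
    off-first : ∀ {z w} u r c → c ≢ i → R z u r c ≡ R w u r c
    off-first u r c c≢i rewrite dec-false (c ≟ i) c≢i = refl
    off-second : ∀ u {z w} r c → c ≢ j → R u z r c ≡ R u w r c
    off-second u r c c≢j rewrite dec-false (c ≟ j) c≢j = refl
    additive-first : ∀ u → D s u ≡ D x u + D y u
    additive-first u = trans (det-linear n i (+ 1) (+ 1) {R s u} {R x u} {R y u}
      (λ r → trans (replaceColumns-first i j i≢j s u M r) (trans (one (x r) (y r))
        (sym (cong₂ (λ a b → + 1 * a + + 1 * b) (replaceColumns-first i j i≢j x u M r) (replaceColumns-first i j i≢j y u M r)))))
      (off-first u) (off-first u)) (one′ (D x u) (D y u))
    additive-second : ∀ u → D u s ≡ D u x + D u y
    additive-second u = trans (det-linear n j (+ 1) (+ 1) {R u s} {R u x} {R u y}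
      (λ r → trans (replaceColumns-second i j i≢j u s M r) (trans (one (x r) (y r))
        (sym (cong₂ (λ a b → + 1 * a + + 1 * b) (replaceColumns-second i j i≢j u x M r) (replaceColumns-second i j i≢j u y M r)))))
      (off-second u) (off-second u)) (one′ (D u x) (D u y))
    expansion : (+ 0 + D x y) + (D y x + + 0) ≡ + 0
    expansion = begin
      (+ 0 + D x y) + (D y x + + 0)         ≡⟨ cong₂ (λ a b → (a + D x y) + (D y x + b)) (sym (vanish x)) (sym (vanish y)) ⟩
      (D x x + D x y) + (D y x + D y y)     ≡⟨ sym (cong₂ _+_ (additive-second x) (additive-second y)) ⟩
      D x s + D y s                         ≡⟨ sym (additive-first s) ⟩
      D s s                                 ≡⟨ vanish s ⟩
      + 0                                   ∎
    negate : ∀ a b → (+ 0 + a) + (b + + 0) ≡ + 0 → b ≡ - a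
    negate a b h = trans (lemma a b) (trans (cong (λ z → z + - a) h) (+-identityˡ (- a)))
      where
      lemma : ∀ a b → b ≡ ((+ 0 + a) + (b + + 0)) + - a
      lemma = solve-∀

  -- The copy of the first column is moved one place to the left by an adjacent swap, until it is
  -- next to the first column and `det-equal-adjacent` applies.
  det-equal-first : ∀ n (j : Fin n) (M : Matrix (suc n)) → (∀ r → M r zero ≡ M r (suc j)) → det (suc n) M ≡ + 0
  det-equal-first (suc n) = <-weakInduction P (λ M → det-equal-adjacent (2 ℕ.+ n) zero⋖ M) next
    where
    P : Fin (suc n) → Set
    P j = (M : Matrix (2 ℕ.+ n)) → (∀ r → M r zero ≡ M r (suc j)) → det (2 ℕ.+ n) M ≡ + 0
    double-neg : ∀ x → - (- x) ≡ x
    double-neg = solve-∀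
    next : ∀ i → P (inject₁ i) → P (suc i)
    next i ih M h = begin
      det (2 ℕ.+ n) M         ≡⟨ sym (double-neg (det (2 ℕ.+ n) M)) ⟩
      - (- det (2 ℕ.+ n) M)   ≡⟨ cong -_ (sym (det-swap-adjacent (2 ℕ.+ n) p⋖q M M′ first second other)) ⟩
      - det (2 ℕ.+ n) M′      ≡⟨ cong -_ (ih M′ (λ r → trans (other r zero (λ ()) (λ ())) (trans (h r) (sym (first r))))) ⟩
      + 0                     ∎
      where
      p q : Fin (2 ℕ.+ n)
      p = suc (inject₁ i)
      q = suc (suc i)
      p⋖q : p ⋖ q
      p⋖q = inject₁⋖suc (suc i)
      M′ : Matrix (2 ℕ.+ n)
      M′ = replaceColumns p q (λ r → M r q) (λ r → M r p) M
      first = replaceColumns-first p q (⋖⇒≢ p⋖q) (λ r → M r q) (λ r → M r p) M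
      second = replaceColumns-second p q (⋖⇒≢ p⋖q) (λ r → M r q) (λ r → M r p) M
      other = replaceColumns-other p q (⋖⇒≢ p⋖q) (λ r → M r q) (λ r → M r p) M

  replaceFirst : ∀ {n} → (Fin (suc n) → ℤ) → Matrix (suc n) → Matrix (suc n)
  replaceFirst x M r zero    = x r
  replaceFirst x M r (suc c) = M r (suc c)

  det-replaceFirst-cong : ∀ n M {x y : Fin (suc n) → ℤ} → (∀ r → x r ≡ y r) →
    det (suc n) (replaceFirst x M) ≡ det (suc n) (replaceFirst y M)
  det-replaceFirst-cong n M {x} {y} h = det-cong (suc n) {replaceFirst x M} {replaceFirst y M}
    λ { r zero → h r ; r (suc c) → refl }

  det-replaceFirst-linear : ∀ n a b (x y : Fin (suc n) → ℤ) M →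
    det (suc n) (replaceFirst (λ r → a * x r + b * y r) M) ≡
    a * det (suc n) (replaceFirst x M) + b * det (suc n) (replaceFirst y M)
  det-replaceFirst-linear n a b x y M = det-linear (suc n) zero a b (λ _ → refl) off off
    where
    off : ∀ {x y} r c → c ≢ zero → replaceFirst x M r c ≡ replaceFirst y M r c
    off r zero    c≢0 = ⊥-elim (c≢0 refl)
    off r (suc c) c≢0 = refl

  det-replaceFirst-sum : ∀ n p (w : Fin p → ℤ) (x : Fin p → Fin (suc n) → ℤ) M →
    det (suc n) (replaceFirst (λ r → sumFin p (λ q → w q * x q r)) M) ≡
    sumFin p (λ q → w q * det (suc n) (replaceFirst (x q) M))
  det-replaceFirst-sum n zero    w x M = det-zero-column (suc n) zero (replaceFirst (λ _ → + 0) M) (λ _ → refl)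
  det-replaceFirst-sum n (suc p) w x M = begin
    det (suc n) (replaceFirst (λ r → w zero * x zero r + tail r) M)       ≡⟨ det-replaceFirst-cong n M (λ r → +-congˡ (w zero * x zero r) (sym (*-identityˡ (tail r)))) ⟩
    det (suc n) (replaceFirst (λ r → w zero * x zero r + + 1 * tail r) M) ≡⟨ det-replaceFirst-linear n (w zero) (+ 1) (x zero) tail M ⟩
    w zero * D (x zero) + + 1 * D tail                                    ≡⟨ +-congˡ (w zero * D (x zero)) (trans (*-identityˡ (D tail)) (det-replaceFirst-sum n p (λ q → w (suc q)) (λ q → x (suc q)) M)) ⟩
    sumFin (suc p) (λ q → w q * D (x q))                                  ∎
    where
    D : (Fin (suc n) → ℤ) → ℤ
    D x = det (suc n) (replaceFirst x M)
    tail : Fin (suc n) → ℤ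
    tail r = sumFin p (λ q → w (suc q) * x (suc q) r)

  -- Each subtracted column, placed first, repeats a later column and contributes zero. Scaling the
  -- first column by d takes the place of dividing `w` by d.
  det-combineFirst : ∀ n d (w : Fin n → ℤ) M →
    det (suc n) (replaceFirst (λ r → d * M r zero + (- + 1) * sumFin n (λ c → w c * M r (suc c))) M) ≡ d * det (suc n) M
  det-combineFirst n d w M = begin
    det (suc n) (replaceFirst (λ r → d * M r zero + (- + 1) * z r) M)                      ≡⟨ det-replaceFirst-linear n d (- + 1) (λ r → M r zero) z M ⟩
    d * det (suc n) (replaceFirst (λ r → M r zero) M) + (- + 1) * det (suc n) (replaceFirst z M) ≡⟨ cong₂ (λ a b → d * a + (- + 1) * b) (det-cong (suc n) {replaceFirst (λ r → M r zero) M} {M} (λ { r zero → refl ; r (suc c) → refl })) vanish ⟩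
    d * det (suc n) M + (- + 1) * + 0                                                        ≡⟨ +-identityʳ (d * det (suc n) M) ⟩
    d * det (suc n) M                                                                      ∎
    where
    z : Fin (suc n) → ℤ
    z r = sumFin n (λ c → w c * M r (suc c))
    vanish : det (suc n) (replaceFirst z M) ≡ + 0
    vanish = trans (det-replaceFirst-sum n n w (λ c r → M r (suc c)) M)
      (sum-zero n (λ c → trans (cong (w c *_) (det-equal-first n c (replaceFirst (λ r → M r (suc c)) M) (λ r → refl))) (*-zeroʳ (w c))))

  addFirst : ∀ {n} → (Fin n → ℤ) → Matrix (suc n) → Matrix (suc n)
  addFirst t M r zero    = M r zero
  addFirst t M r (suc c) = M r (suc c) + t c * M r zero

  det-addFirst : ∀ n (t : Fin n → ℤ) M → det (suc n) (addFirst t M) ≡ det (suc n) M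
  det-addFirst n t M = go n t (λ c n≤c → ⊥-elim (ℕₚ.<⇒≱ (toℕ<n c) n≤c))
    where
    -- Induction on a bound `k` beyond which the coefficients vanish. Linearity in the last column
    -- that may change splits off a matrix whose copy of the first column makes its determinant
    -- zero.
    go : ∀ k (t : Fin n → ℤ) → (∀ c → k ℕ.≤ toℕ c → t c ≡ + 0) → det (suc n) (addFirst t M) ≡ det (suc n) M
    go zero t h = det-cong (suc n) {addFirst t M} {M} λ
      { r zero    → refl
      ; r (suc c) → trans (cong (λ a → M r (suc c) + a * M r zero) (h c z≤n)) (+-identityʳ (M r (suc c))) }
    go (suc k) t h with k ℕ.<? n
    ... | no k≮n = go k t (λ c k≤c → ⊥-elim (k≮n (ℕₚ.≤-<-trans k≤c (toℕ<n c))))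
    ... | yes k<n = begin
      det (suc n) (addFirst t M)                            ≡⟨ det-linear (suc n) (suc q) (+ 1) (t q) {addFirst t M} {addFirst t′ M} {X} at-q off-q off-X ⟩
      + 1 * det (suc n) (addFirst t′ M) + t q * det (suc n) X ≡⟨ cong₂ (λ a b → + 1 * a + t q * b) (go k t′ h′) (det-equal-first n q X X-equal) ⟩
      + 1 * det (suc n) M + t q * + 0                       ≡⟨ simplify (det (suc n) M) (t q) ⟩
      det (suc n) M                                         ∎
      where
      q = fromℕ< k<n
      t′ : Fin n → ℤ
      t′ c = if does (c ≟ q) then + 0 else t c
      X : Matrix (suc n)
      X r zero    = M r zero
      X r (suc c) = if does (c ≟ q) then M r zero else addFirst t M r (suc c)
      simplify : ∀ a b → + 1 * a + b * + 0 ≡ a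
      simplify = solve-∀
      split : ∀ a b c → a + b * c ≡ + 1 * (a + + 0 * c) + b * c
      split = solve-∀
      at-q : ∀ r → addFirst t M r (suc q) ≡ + 1 * addFirst t′ M r (suc q) + t q * X r (suc q)
      at-q r rewrite dec-true (q ≟ q) refl = split (M r (suc q)) (t q) (M r zero)
      off-q : ∀ r c → c ≢ suc q → addFirst t M r c ≡ addFirst t′ M r c
      off-q r zero    _  = refl
      off-q r (suc c) ne rewrite dec-false (c ≟ q) (λ e → ne (cong suc e)) = refl
      off-X : ∀ r c → c ≢ suc q → addFirst t M r c ≡ X r c
      off-X r zero    _  = refl
      off-X r (suc c) ne rewrite dec-false (c ≟ q) (λ e → ne (cong suc e)) = refl
      X-equal : ∀ r → X r zero ≡ X r (suc q)
      X-equal r rewrite dec-true (q ≟ q) refl = refl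
      h′ : ∀ c → k ℕ.≤ toℕ c → t′ c ≡ + 0
      h′ c k≤c with c ≟ q
      ... | yes _  = refl
      ... | no c≢q = h c (ℕₚ.≤∧≢⇒< k≤c (λ e → c≢q (toℕ-injective (trans (sym e) (sym (toℕ-fromℕ< k<n))))))

  det-first-row : ∀ n (M : Matrix (suc n)) → (∀ c → M zero (suc c) ≡ + 0) →
    det (suc n) M ≡ M zero zero * det n (λ r c → M (suc r) (suc c))
  det-first-row n M h = begin
    + 1 * M zero zero * D + sumFin n (λ c → sign (suc c) * M zero (suc c) * E c)
      ≡⟨ +-congˡ (+ 1 * M zero zero * D) (sum-zero n (λ c → trans (cong (λ x → sign (suc c) * x * E c) (h c)) (vanish (sign (suc c)) (E c)))) ⟩
    + 1 * M zero zero * D + + 0 ≡⟨ simplify (M zero zero) D ⟩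
    M zero zero * D             ∎
    where
    D = det n (minor M zero)
    E : Fin n → ℤ
    E c = det n (minor M (suc c))
    vanish : ∀ s e → s * + 0 * e ≡ + 0
    vanish = solve-∀
    simplify : ∀ a b → + 1 * a * b + + 0 ≡ a * b
    simplify = solve-∀

  -- Every minor but the first retains column `zero` without its top entry, which is a zero column.
  det-first-column : ∀ n (M : Matrix (suc n)) → (∀ r → M (suc r) zero ≡ + 0) →
    det (suc n) M ≡ M zero zero * det n (λ r c → M (suc r) (suc c))
  det-first-column n M h = begin
    + 1 * M zero zero * D + sumFin n (λ c → sign (suc c) * M zero (suc c) * E c)
      ≡⟨ +-congˡ (+ 1 * M zero zero * D) (sum-zero n (λ c → trans (cong (sign (suc c) * M zero (suc c) *_) (E≡0 c)) (*-zeroʳ (sign (suc c) * M zero (suc c))))) ⟩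
    + 1 * M zero zero * D + + 0 ≡⟨ simplify (M zero zero) D ⟩
    M zero zero * D             ∎
    where
    D = det n (minor M zero)
    E : Fin n → ℤ
    E c = det n (minor M (suc c))
    E≡0 : ∀ c → E c ≡ + 0
    E≡0 zero    = det-zero-column _ zero (minor M (suc zero)) h
    E≡0 (suc c) = det-zero-column _ zero (minor M (suc (suc c))) h
    simplify : ∀ a b → + 1 * a * b + + 0 ≡ a * b
    simplify = solve-∀

  -- The block matrix with corner 1. The Schur complement of the corner is A - u vᵀ, that of A is 1
  -- - v · A⁻¹ u; equating the two factorisations of its determinant is the matrix determinant
  -- lemma.
  bordered : ∀ {n} → (u v : Fin n → ℤ) → Matrix n → Matrix (suc n)
  bordered u v A zero    zero    = + 1
  bordered u v A zero    (suc c) = v c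
  bordered u v A (suc r) zero    = u r
  bordered u v A (suc r) (suc c) = A r c

  -- Both sides evaluate d · det (bordered u v A): once by clearing the first row
  -- with the first column, once by clearing the first column with the solution w.
  det-rank-one-update : ∀ n (A : Matrix n) (u v w : Fin n → ℤ) d →
    (∀ r → sumFin n (λ c → w c * A r c) ≡ d * u r) →
    d * det n (λ r c → A r c + - (u r * v c)) ≡ (d + - sumFin n (λ c → w c * v c)) * det n A
  det-rank-one-update n A u v w d h = begin
    d * det n (λ r c → A r c + - (u r * v c)) ≡⟨ cong (d *_) (sym row) ⟩
    d * det (suc n) B                         ≡⟨ sym (det-combineFirst n d w B) ⟩
    det (suc n) B′                            ≡⟨ det-first-column n B′ (λ r → trans (cong (λ z → d * u r + (- + 1) * z) (h r)) (cancel (d * u r))) ⟩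
    (d * + 1 + (- + 1) * sumFin n (λ c → w c * v c)) * det n A ≡⟨ cong (_* det n A) (tidy d (sumFin n (λ c → w c * v c))) ⟩
    (d + - sumFin n (λ c → w c * v c)) * det n A ∎
    where
    B = bordered u v A
    B′ = replaceFirst (λ r → d * B r zero + (- + 1) * sumFin n (λ c → w c * B r (suc c))) B
    cancel : ∀ x → x + (- + 1) * x ≡ + 0
    cancel = solve-∀
    cancel′ : ∀ x → x + - x * + 1 ≡ + 0
    cancel′ = solve-∀
    tidy : ∀ d x → d * + 1 + (- + 1) * x ≡ d + - x
    tidy = solve-∀
    commute : ∀ a u v → a + - v * u ≡ a + - (u * v)
    commute = solve-∀
    row : det (suc n) B ≡ det n (λ r c → A r c + - (u r * v c))
    row = begin
      det (suc n) B                              ≡⟨ sym (det-addFirst n (λ c → - v c) B) ⟩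
      det (suc n) (addFirst (λ c → - v c) B)     ≡⟨ det-first-row n (addFirst (λ c → - v c) B) (λ c → cancel′ (v c)) ⟩
      + 1 * det n (λ r c → A r c + - v c * u r)  ≡⟨ *-identityˡ (det n (λ r c → A r c + - v c * u r)) ⟩
      det n (λ r c → A r c + - v c * u r)        ≡⟨ det-cong n (λ r c → commute (A r c) (u r) (v c)) ⟩
      det n (λ r c → A r c + - (u r * v c))      ∎

  det-scale : ∀ n s (M : Matrix n) → det n (λ r c → s * M r c) ≡ s ^ n * det n M
  det-scale zero    s M = refl
  det-scale (suc n) s M = trans
    (sum-cong (suc n) (λ j → trans (cong (sign j * (s * M zero j) *_) (det-scale n s (minor M j)))
      (lemma (sign j) s (M zero j) (s ^ n) (det n (minor M j)))))
    (sum-*ˡ (suc n) (s ^ suc n) (λ j → sign j * M zero j * det n (minor M j)))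
    where
    lemma : ∀ g s x p D → g * (s * x) * (p * D) ≡ s * p * (g * x * D)
    lemma = solve-∀

  det-scalar : ∀ n s → det n (λ r c → s * ⟦ r ≟ c ⟧) ≡ s ^ n
  det-scalar zero    s = refl
  det-scalar (suc n) s = begin
    det (suc n) (λ r c → s * ⟦ r ≟ c ⟧)                    ≡⟨ det-first-row n (λ r c → s * ⟦ r ≟ c ⟧) (λ c → *-zeroʳ s) ⟩
    s * + 1 * det n (λ r c → s * ⟦ suc r ≟ suc c ⟧)        ≡⟨ cong₂ _*_ (*-identityʳ s) (det-cong n (λ r c → cong (s *_) (⟦⟧-⇔ (suc r ≟ suc c) (r ≟ c) suc-injective (cong suc)))) ⟩
    s * det n (λ r c → s * ⟦ r ≟ c ⟧)                      ≡⟨ cong (s *_) (det-scalar n s) ⟩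
    s ^ suc n                                              ∎

-- Edges of the complete graph and the vertex-edge incidence matrix.

module CompleteGraph where
  open Summation
  open import Data.Integer using (_+_; _*_; _-_)
  open import Data.List.Membership.Propositional using (_∈_)

  -- A sum over the positions of the list, because edges are positions in `edgesK n` and trees are
  -- positions in `Ts`.
  sumList : {A : Set} → (A → ℤ) → List A → ℤ
  sumList g xs = sumFin (length xs) (λ i → g (lookup xs i))

  module _ {A : Set} where

    sumList-++ : ∀ (g : A → ℤ) xs ys → sumList g (xs ++ ys) ≡ sumList g xs + sumList g ys
    sumList-++ g []       ys = sym (+-identityˡ (sumList g ys))
    sumList-++ g (x ∷ xs) ys = trans (+-congˡ (g x) (sumList-++ g xs ys)) (sym (+-assoc (g x) (sumList g xs) (sumList g ys)))

    sumList-tabulate : ∀ n (g : A → ℤ) (f : Fin n → A) → sumList g (tabulate f) ≡ sumFin n (λ i → g (f i))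
    sumList-tabulate zero    g f = refl
    sumList-tabulate (suc n) g f = +-congˡ (g (f zero)) (sumList-tabulate n g (λ i → f (suc i)))

    sumList-filter : ∀ {P : Pred A _} (P? : Decidable P) (g : A → ℤ) xs →
      sumList g (filter P? xs) ≡ sumList (λ x → ⟦ P? x ⟧ * g x) xs
    sumList-filter P? g []       = refl
    sumList-filter P? g (x ∷ xs) with does (P? x)
    ... | true  = cong₂ _+_ (sym (*-identityˡ (g x))) (sumList-filter P? g xs)
    ... | false = trans (sumList-filter P? g xs) (trans (sym (+-identityˡ rest)) (cong (λ z → z + rest) (sym (*-zeroˡ (g x)))))
      where rest = sumList (λ x → ⟦ P? x ⟧ * g x) xs

    lookup-injective : ∀ {xs : List A} → Unique xs → ∀ i j → lookup xs i ≡ lookup xs j → i ≡ j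
    lookup-injective (_  ∷ _)   zero    zero    e = refl
    lookup-injective (x∉ ∷ _)   zero    (suc j) e = ⊥-elim (All.lookup x∉ (∈-lookup j) e)
    lookup-injective (x∉ ∷ _)   (suc i) zero    e = ⊥-elim (All.lookup x∉ (∈-lookup i) (sym e))
    lookup-injective (_  ∷ xs!) (suc i) (suc j) e = cong suc (lookup-injective xs! i j e)

  module _ {A B : Set} where

    sumList-map : ∀ (g : B → ℤ) (f : A → B) xs → sumList g (map f xs) ≡ sumList (λ x → g (f x)) xs
    sumList-map g f []       = refl
    sumList-map g f (x ∷ xs) = +-congˡ (g (f x)) (sumList-map g f xs)

    sumList-concatMap : ∀ (g : B → ℤ) (f : A → List B) xs →
      sumList g (concatMap f xs) ≡ sumList (λ x → sumList g (f x)) xs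
    sumList-concatMap g f []       = refl
    sumList-concatMap g f (x ∷ xs) =
      trans (sumList-++ g (f x) (concatMap f xs)) (+-congˡ (sumList g (f x)) (sumList-concatMap g f xs))

  module EdgeSums (n : ℕ) where

    E : ℕ
    E = m n

    src tgt : Fin E → Fin n
    src e = proj₁ (ends n e)
    tgt e = proj₂ (ends n e)

    edgesFrom : Fin n → List (Fin n × Fin n)
    edgesFrom i = map (i ,_) (filter (i Fin.<?_) (allFin n))

    src<tgt : ∀ e → src e Fin.< tgt e
    src<tgt e with satisfied (∈-concatMap⁻ edgesFrom {allFin n} (∈-lookup e))
    ... | i , p∈ with ∈-map⁻ (i ,_) p∈
    ...   | j , j∈ , p≡ rewrite p≡ = proj₂ (∈-filter⁻ (i Fin.<?_) {xs = allFin n} j∈)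

    src≢tgt : ∀ e → src e ≢ tgt e
    src≢tgt e eq = Finₚ.<-irrefl eq (src<tgt e)

    -- Within the block of one source the target distinguishes the pairs, and different blocks have
    -- different sources.
    edgesK-unique : Unique (edgesK n)
    edgesK-unique = Uniqueₚ.concat⁺
      (Allₚ.map⁺ (All.tabulate λ {i} _ → Uniqueₚ.map⁺ (cong proj₂) (Uniqueₚ.filter⁺ (i Fin.<?_) (Uniqueₚ.allFin⁺ n))))
      (AllPairsₚ.map⁺ (AllPairs.map
        (λ {i} {j} i≢j {v} (v∈i , v∈j) → i≢j (trans (sym (source i v v∈i)) (source j v v∈j)))
        (Uniqueₚ.allFin⁺ n)))
      where
      source : ∀ i v → v ∈ edgesFrom i → proj₁ v ≡ i
      source i v v∈ with ∈-map⁻ (i ,_) v∈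
      ... | _ , _ , refl = refl

    ends-injective : ∀ e f → src e ≡ src f → tgt e ≡ tgt f → e ≡ f
    ends-injective e f p q = lookup-injective edgesK-unique e f (cong₂ _,_ p q)

    sum-edges : ∀ (g : Fin n → Fin n → ℤ) →
      sumFin E (λ e → g (src e) (tgt e)) ≡ sumFin n (λ u → sumFin n (λ v → ⟦ u Fin.<? v ⟧ * g u v))
    sum-edges g = begin
      sumList g′ (edgesK n)                                    ≡⟨ sumList-concatMap g′ edgesFrom (allFin n) ⟩
      sumList (λ u → sumList g′ (edgesFrom u)) (allFin n)      ≡⟨ sumList-tabulate n (λ u → sumList g′ (edgesFrom u)) (λ u → u) ⟩
      sumFin n (λ u → sumList g′ (edgesFrom u))                ≡⟨ sum-cong n inner ⟩
      sumFin n (λ u → sumFin n (λ v → ⟦ u Fin.<? v ⟧ * g u v)) ∎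
      where
      g′ : Fin n × Fin n → ℤ
      g′ p = g (proj₁ p) (proj₂ p)
      inner : ∀ u → sumList g′ (edgesFrom u) ≡ sumFin n (λ v → ⟦ u Fin.<? v ⟧ * g u v)
      inner u = trans (sumList-map g′ (u ,_) (filter (u Fin.<?_) (allFin n)))
        (trans (sumList-filter (u Fin.<?_) (g u) (allFin n)) (sumList-tabulate n (λ v → ⟦ u Fin.<? v ⟧ * g u v) (λ v → v)))

    -- By trichotomy an ordered pair of vertices lies on the diagonal or is exactly one orientation
    -- of one edge. Edge sums thus become free double sums over vertices, in which the order `u < v`
    -- no longer occurs.
    sum-edges-sym : ∀ (g : Fin n → Fin n → ℤ) →
      sumFin E (λ e → g (src e) (tgt e) + g (tgt e) (src e)) + sumFin n (λ u → g u u) ≡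
      sumFin n (λ u → sumFin n (g u))
    sum-edges-sym g = begin
      sumFin E (λ e → g (src e) (tgt e) + g (tgt e) (src e)) + diag   ≡⟨ cong (λ z → z + diag) (sum-+ E (λ e → g (src e) (tgt e)) (λ e → g (tgt e) (src e))) ⟩
      sumFin E (λ e → g (src e) (tgt e)) + sumFin E (λ e → g (tgt e) (src e)) + diag
        ≡⟨ cong₂ (λ a b → a + b + diag) (sum-edges g) (trans (sum-edges (λ u v → g v u)) (sum-swap n n (λ u v → ⟦ u Fin.<? v ⟧ * g v u))) ⟩
      ΣΣ up + ΣΣ down + diag                                          ≡⟨ +-congˡ (ΣΣ up + ΣΣ down) (sym (sum-cong n (λ u → sum-δ n u (g u)))) ⟩
      ΣΣ up + ΣΣ down + ΣΣ level                                      ≡⟨ sym (trans (ΣΣ-+ (λ u v → up u v + down u v) level) (cong (λ z → z + ΣΣ level) (ΣΣ-+ up down))) ⟩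
      ΣΣ (λ u v → up u v + down u v + level u v)                      ≡⟨ sum-cong n (λ u → sum-cong n (trichotomy u)) ⟩
      ΣΣ g                                                            ∎
      where
      diag = sumFin n (λ u → g u u)
      ΣΣ : (Fin n → Fin n → ℤ) → ℤ
      ΣΣ f = sumFin n (λ u → sumFin n (f u))
      up down level : Fin n → Fin n → ℤ
      up    u v = ⟦ u Fin.<? v ⟧ * g u v
      down  u v = ⟦ v Fin.<? u ⟧ * g u v
      level u v = ⟦ u ≟ v ⟧ * g u v
      ΣΣ-+ : ∀ f h → ΣΣ (λ u v → f u v + h u v) ≡ ΣΣ f + ΣΣ h
      ΣΣ-+ f h = trans (sum-cong n (λ u → sum-+ n (f u) (h u))) (sum-+ n (λ u → sumFin n (f u)) (λ u → sumFin n (h u)))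
      total : ∀ a b c x → a + b + c ≡ + 1 → a * x + b * x + c * x ≡ x
      total a b c x h = trans (lemma a b c x) (trans (cong (_* x) h) (*-identityˡ x))
        where
        lemma : ∀ a b c x → a * x + b * x + c * x ≡ (a + b + c) * x
        lemma = solve-∀
      trichotomy : ∀ u v → up u v + down u v + level u v ≡ g u v
      trichotomy u v = total ⟦ u Fin.<? v ⟧ ⟦ v Fin.<? u ⟧ ⟦ u ≟ v ⟧ (g u v) one
        where
        one : ⟦ u Fin.<? v ⟧ + ⟦ v Fin.<? u ⟧ + ⟦ u ≟ v ⟧ ≡ + 1
        one with Finₚ.<-cmp u v
        ... | tri< u<v u≢v v≮u = cong₂ _+_ (cong₂ _+_ (⟦⟧-yes (u Fin.<? v) u<v) (⟦⟧-no (v Fin.<? u) v≮u)) (⟦⟧-no (u ≟ v) u≢v)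
        ... | tri≈ u≮v u≡v v≮u = cong₂ _+_ (cong₂ _+_ (⟦⟧-no (u Fin.<? v) u≮v) (⟦⟧-no (v Fin.<? u) v≮u)) (⟦⟧-yes (u ≟ v) u≡v)
        ... | tri> u≮v u≢v v<u = cong₂ _+_ (cong₂ _+_ (⟦⟧-no (u Fin.<? v) u≮v) (⟦⟧-yes (v Fin.<? u) v<u)) (⟦⟧-no (u ≟ v) u≢v)

    N : Fin n → Fin E → ℤ
    N v e = ⟦ v ≟ src e ⟧ + ⟦ v ≟ tgt e ⟧

    ν : ℤ
    ν = + n

    edge-count : + E * + 2 ≡ ν * ν - ν
    edge-count = +-moveʳ {+ E * + 2} {ν} {ν * ν} (begin
      + E * + 2 + ν                                                    ≡⟨ cong₂ _+_ (sym (sum-const E (+ 2))) (sym (trans (sum-const n (+ 1)) (*-identityʳ ν))) ⟩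
      sumFin E (λ _ → + 1 + + 1) + sumFin n (λ _ → + 1)                ≡⟨ sum-edges-sym (λ _ _ → + 1) ⟩
      sumFin n (λ _ → sumFin n (λ _ → + 1))                            ≡⟨ sum-const n (sumFin n (λ _ → + 1)) ⟩
      ν * sumFin n (λ _ → + 1)                                         ≡⟨ cong (ν *_) (trans (sum-const n (+ 1)) (*-identityʳ ν)) ⟩
      ν * ν                                                            ∎)

    -- Each vertex lies on n - 1 edges and two distinct vertices share one, so N Nᵀ = (n - 2) I + J.
    -- The passage to ordered pairs yields both cases in one computation.
    N-inner : ∀ u v → sumFin E (λ e → N u e * N v e) ≡ (ν - + 2) * ⟦ u ≟ v ⟧ + + 1
    N-inner u v = begin
      sumFin E (λ e → N u e * N v e)                                     ≡⟨ sum-cong E (λ e → expand ⟦ u ≟ src e ⟧ ⟦ u ≟ tgt e ⟧ ⟦ v ≟ src e ⟧ ⟦ v ≟ tgt e ⟧) ⟩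
      sumFin E (λ e → g (src e) (tgt e) + g (tgt e) (src e))             ≡⟨ +-moveʳ {sumFin E (λ e → g (src e) (tgt e) + g (tgt e) (src e))} {+ 2 * δ} {ν * δ + + 1} (trans (+-congˡ (sumFin E (λ e → g (src e) (tgt e) + g (tgt e) (src e))) (sym diag)) (trans (sum-edges-sym g) all)) ⟩
      ν * δ + + 1 - + 2 * δ                                              ≡⟨ collect ν δ ⟩
      (ν - + 2) * δ + + 1                                                ∎
      where
      δ = ⟦ u ≟ v ⟧
      g : Fin n → Fin n → ℤ
      -- `g` collects the two products that contain `⟦ u ≟ a ⟧`; the other two of the expanded
      -- product are `g` with its arguments exchanged, as `sum-edges-sym` requires.
      g a b = ⟦ u ≟ a ⟧ * ⟦ v ≟ a ⟧ + ⟦ u ≟ a ⟧ * ⟦ v ≟ b ⟧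
      expand : ∀ a b c d → (a + b) * (c + d) ≡ (a * c + a * d) + (b * d + b * c)
      expand = solve-∀
      collect : ∀ x d → x * d + + 1 - + 2 * d ≡ (x - + 2) * d + + 1
      collect = solve-∀
      twice : ∀ x → x + x ≡ + 2 * x
      twice = solve-∀
      δδ : sumFin n (λ a → ⟦ u ≟ a ⟧ * ⟦ v ≟ a ⟧) ≡ δ
      δδ = trans (sum-δ n u (λ a → ⟦ v ≟ a ⟧)) (δ-sym v u)
      diag : sumFin n (λ a → g a a) ≡ + 2 * δ
      diag = trans (sum-+ n (λ a → ⟦ u ≟ a ⟧ * ⟦ v ≟ a ⟧) (λ a → ⟦ u ≟ a ⟧ * ⟦ v ≟ a ⟧)) (trans (cong₂ _+_ δδ δδ) (twice δ))
      inner : ∀ a → sumFin n (g a) ≡ ν * (⟦ u ≟ a ⟧ * ⟦ v ≟ a ⟧) + ⟦ u ≟ a ⟧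
      inner a = trans (sum-+ n (λ b → ⟦ u ≟ a ⟧ * ⟦ v ≟ a ⟧) (λ b → ⟦ u ≟ a ⟧ * ⟦ v ≟ b ⟧))
        (cong₂ _+_ (sum-const n (⟦ u ≟ a ⟧ * ⟦ v ≟ a ⟧))
          (trans (sum-*ˡ n ⟦ u ≟ a ⟧ (λ b → ⟦ v ≟ b ⟧)) (trans (cong (⟦ u ≟ a ⟧ *_) (sum-δ-one n v)) (*-identityʳ ⟦ u ≟ a ⟧))))
      all : sumFin n (λ a → sumFin n (g a)) ≡ ν * δ + + 1
      all = trans (sum-cong n inner) (trans (sum-+ n (λ a → ν * (⟦ u ≟ a ⟧ * ⟦ v ≟ a ⟧)) (λ a → ⟦ u ≟ a ⟧))
        (cong₂ _+_ (trans (sum-*ˡ n ν (λ a → ⟦ u ≟ a ⟧ * ⟦ v ≟ a ⟧)) (cong (ν *_) δδ)) (sum-δ-one n u)))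

    N-degree : ∀ v → sumFin E (N v) ≡ ν - + 1
    N-degree v = +-moveʳ {sumFin E (N v)} {+ 1} {ν} (begin
      sumFin E (N v) + + 1                          ≡⟨ +-congˡ (sumFin E (N v)) (sym (sum-δ-one n v)) ⟩
      sumFin E (N v) + sumFin n (λ a → ⟦ v ≟ a ⟧)   ≡⟨ sum-edges-sym (λ a _ → ⟦ v ≟ a ⟧) ⟩
      sumFin n (λ a → sumFin n (λ _ → ⟦ v ≟ a ⟧))   ≡⟨ sum-cong n (λ a → sum-const n ⟦ v ≟ a ⟧) ⟩
      sumFin n (λ a → ν * ⟦ v ≟ a ⟧)                ≡⟨ trans (sum-*ˡ n ν (λ a → ⟦ v ≟ a ⟧)) (cong (ν *_) (sum-δ-one n v)) ⟩
      ν * + 1                                       ≡⟨ *-identityʳ ν ⟩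
      ν                                             ∎)

    N-column : ∀ e → sumFin n (λ v → N v e) ≡ + 2
    N-column e = trans (sum-+ n (λ v → ⟦ v ≟ src e ⟧) (λ v → ⟦ v ≟ tgt e ⟧)) (cong₂ _+_ (one (src e)) (one (tgt e)))
      where
      one : ∀ u → sumFin n (λ v → ⟦ v ≟ u ⟧) ≡ + 1
      one u = trans (sum-cong n (λ v → δ-sym v u)) (sum-δ-one n u)

-- The determinant of 4 J - 2 I - Nᵀ N.

module IncidenceSpectrum where
  open Summation
  open Determinants
  open CompleteGraph
  open import Data.Integer using (_+_; _*_; _-_; _^_)

  pos-≢0 : ∀ n k → 0 ℕ.< n → + n + + k ≢ + 0
  pos-≢0 (suc n) k _ ()

  -- Marks the vertices whose rank-one term has already been subtracted in `A k`.
  χ : ∀ {n} → ℕ → Fin n → ℤ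
  χ k v = ⟦ toℕ v ℕ.<? k ⟧

  sum-χ : ∀ n k → k ℕ.≤ n → sumFin n (χ k) ≡ + k
  sum-χ zero    zero    z≤n       = refl
  sum-χ (suc n) zero    z≤n       = sum-zero (suc n) (λ v → ⟦⟧-no (toℕ v ℕ.<? 0) (λ ()))
  sum-χ (suc n) (suc k) (s≤s k≤n) = cong₂ _+_ (⟦⟧-yes (0 ℕ.<? suc k) (s≤s z≤n))
    (trans (sum-cong n (λ v → ⟦⟧-⇔ (suc (toℕ v) ℕ.<? suc k) (toℕ v ℕ.<? k) ℕₚ.≤-pred s≤s)) (sum-χ n k k≤n))

  χ-suc : ∀ {n} (q v : Fin n) → χ (suc (toℕ q)) v ≡ χ (toℕ q) v + ⟦ q ≟ v ⟧
  χ-suc q v with q ≟ v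
  ... | yes refl = trans (⟦⟧-yes (toℕ q ℕ.<? suc (toℕ q)) ℕₚ.≤-refl) (cong (λ z → z + + 1) (sym (⟦⟧-no (toℕ q ℕ.<? toℕ q) (ℕₚ.<-irrefl refl))))
  ... | no q≢v = trans (⟦⟧-⇔ (toℕ v ℕ.<? suc (toℕ q)) (toℕ v ℕ.<? toℕ q)
      (λ v≤q → ℕₚ.≤∧≢⇒< (ℕₚ.≤-pred v≤q) (λ e → q≢v (Finₚ.toℕ-injective (sym e)))) ℕₚ.m<n⇒m<1+n)
    (sym (+-identityʳ (χ (toℕ q) v)))

  χ-δ : ∀ {n} (q v : Fin n) → χ (toℕ q) v * ⟦ q ≟ v ⟧ ≡ + 0
  χ-δ q v with q ≟ v
  ... | yes refl = cong (_* + 1) (⟦⟧-no (toℕ q ℕ.<? toℕ q) (ℕₚ.<-irrefl refl))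
  ... | no _     = *-zeroʳ (χ (toℕ q) v)

  module Spectrum (n : ℕ) where
    open EdgeSums n

    A : ℕ → Matrix E
    A k r c = (- + 2) * ⟦ r ≟ c ⟧ + - sumFin n (λ v → χ k v * N v r * N v c)

    S : ℕ → Fin E → ℤ
    S k e = sumFin n (λ v → χ k v * N v e)

    -- `A k` sees `w` only through `w` itself and its inner products with the rows of N, so on
    -- combinations of these rows its action is computed from N Nᵀ.
    A-apply : ∀ k (w : Fin E → ℤ) r → sumFin E (λ c → w c * A k r c) ≡
      (- + 2) * w r + - sumFin n (λ v → χ k v * N v r * sumFin E (λ c → w c * N v c))
    A-apply k w r = begin
      sumFin E (λ c → w c * A k r c)
        ≡⟨ sum-cong E (λ c → trans (distrib (w c) ⟦ r ≟ c ⟧ (sumFin n (T c))) (cong (λ z → (- + 2) * (⟦ r ≟ c ⟧ * w c) + (- + 1) * z) (sym (sum-*ˡ n (w c) (T c))))) ⟩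
      sumFin E (λ c → (- + 2) * (⟦ r ≟ c ⟧ * w c) + (- + 1) * sumFin n (λ v → w c * T c v))
        ≡⟨ sum-linear E (- + 2) (- + 1) (λ c → ⟦ r ≟ c ⟧ * w c) (λ c → sumFin n (λ v → w c * T c v)) ⟩
      (- + 2) * sumFin E (λ c → ⟦ r ≟ c ⟧ * w c) + (- + 1) * sumFin E (λ c → sumFin n (λ v → w c * T c v))
        ≡⟨ cong₂ (λ a b → (- + 2) * a + (- + 1) * b) (sum-δ E r w) (trans (sum-swap E n (λ c v → w c * T c v)) (sum-cong n inner)) ⟩
      (- + 2) * w r + (- + 1) * sumFin n (λ v → χ k v * N v r * sumFin E (λ c → w c * N v c))
        ≡⟨ tidy (w r) (sumFin n (λ v → χ k v * N v r * sumFin E (λ c → w c * N v c))) ⟩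
      (- + 2) * w r + - sumFin n (λ v → χ k v * N v r * sumFin E (λ c → w c * N v c)) ∎
      where
      T : Fin E → Fin n → ℤ
      T c v = χ k v * N v r * N v c
      distrib : ∀ w d t → w * ((- + 2) * d + - t) ≡ (- + 2) * (d * w) + (- + 1) * (w * t)
      distrib = solve-∀
      tidy : ∀ a b → (- + 2) * a + (- + 1) * b ≡ (- + 2) * a + - b
      tidy = solve-∀
      reorder : ∀ w x y → w * (x * y) ≡ x * (w * y)
      reorder = solve-∀
      inner : ∀ v → sumFin E (λ c → w c * T c v) ≡ χ k v * N v r * sumFin E (λ c → w c * N v c)
      inner v = trans (sum-cong E (λ c → reorder (w c) (χ k v * N v r) (N v c))) (sum-*ˡ E (χ k v * N v r) (λ c → w c * N v c))

    S-inner : ∀ k → k ℕ.≤ n → ∀ v → sumFin E (λ e → S k e * N v e) ≡ (ν - + 2) * χ k v + + k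
    S-inner k k≤n v = begin
      sumFin E (λ e → S k e * N v e)                               ≡⟨ sum-cong E (λ e → sym (sum-*ʳ n (λ u → χ k u * N u e) (N v e))) ⟩
      sumFin E (λ e → sumFin n (λ u → χ k u * N u e * N v e))      ≡⟨ sum-swap E n (λ e u → χ k u * N u e * N v e) ⟩
      sumFin n (λ u → sumFin E (λ e → χ k u * N u e * N v e))      ≡⟨ sum-cong n inner ⟩
      sumFin n (λ u → (ν - + 2) * (⟦ v ≟ u ⟧ * χ k u) + + 1 * χ k u) ≡⟨ sum-linear n (ν - + 2) (+ 1) (λ u → ⟦ v ≟ u ⟧ * χ k u) (χ k) ⟩
      (ν - + 2) * sumFin n (λ u → ⟦ v ≟ u ⟧ * χ k u) + + 1 * sumFin n (χ k)
        ≡⟨ cong₂ (λ a b → (ν - + 2) * a + b) (sum-δ n v (χ k)) (trans (*-identityˡ (sumFin n (χ k))) (sum-χ n k k≤n)) ⟩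
      (ν - + 2) * χ k v + + k                                      ∎
      where
      assoc : ∀ a b c → a * b * c ≡ a * (b * c)
      assoc = solve-∀
      collect : ∀ x a d → a * ((x - + 2) * d + + 1) ≡ (x - + 2) * (d * a) + + 1 * a
      collect = solve-∀
      inner : ∀ u → sumFin E (λ e → χ k u * N u e * N v e) ≡ (ν - + 2) * (⟦ v ≟ u ⟧ * χ k u) + + 1 * χ k u
      inner u = begin
        sumFin E (λ e → χ k u * N u e * N v e)              ≡⟨ sum-cong E (λ e → assoc (χ k u) (N u e) (N v e)) ⟩
        sumFin E (λ e → χ k u * (N u e * N v e))            ≡⟨ sum-*ˡ E (χ k u) (λ e → N u e * N v e) ⟩
        χ k u * sumFin E (λ e → N u e * N v e)              ≡⟨ cong (χ k u *_) (trans (N-inner u v) (cong (λ z → (ν - + 2) * z + + 1) (δ-sym u v))) ⟩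
        χ k u * ((ν - + 2) * ⟦ v ≟ u ⟧ + + 1)               ≡⟨ collect ν (χ k u) ⟦ v ≟ u ⟧ ⟩
        (ν - + 2) * (⟦ v ≟ u ⟧ * χ k u) + + 1 * χ k u       ∎

    module Step (q : Fin n) where
      k = toℕ q
      κ : ℤ
      κ = + k

      -- For a combination a N_q + b S_k one finds A_k (a N_q + b S_k) = -2 a N_q - (a + b (n + k))
      -- S_k. The choice a = n + k, b = -1 removes the S_k part and leaves the multiple -2 (n + k)
      -- of N_q.
      w : Fin E → ℤ
      w e = (ν + κ) * N q e + (- + 1) * S k e

      w-inner : ∀ v → sumFin E (λ e → w e * N v e) ≡
        (ν + κ) * ((ν - + 2) * ⟦ q ≟ v ⟧ + + 1) + (- + 1) * ((ν - + 2) * χ k v + κ)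
      w-inner v = begin
        sumFin E (λ e → w e * N v e)   ≡⟨ sum-cong E (λ e → distrib (ν + κ) (N q e) (S k e) (N v e)) ⟩
        sumFin E (λ e → (ν + κ) * (N q e * N v e) + (- + 1) * (S k e * N v e))
          ≡⟨ sum-linear E (ν + κ) (- + 1) (λ e → N q e * N v e) (λ e → S k e * N v e) ⟩
        (ν + κ) * sumFin E (λ e → N q e * N v e) + (- + 1) * sumFin E (λ e → S k e * N v e)
          ≡⟨ cong₂ (λ a b → (ν + κ) * a + (- + 1) * b) (N-inner q v) (S-inner k (ℕₚ.<⇒≤ (Finₚ.toℕ<n q)) v) ⟩
        (ν + κ) * ((ν - + 2) * ⟦ q ≟ v ⟧ + + 1) + (- + 1) * ((ν - + 2) * χ k v + κ) ∎
        where
        distrib : ∀ x a s b → (x * a + (- + 1) * s) * b ≡ x * (a * b) + (- + 1) * (s * b)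
        distrib = solve-∀

      A-w : ∀ r → sumFin E (λ c → w c * A k r c) ≡ (- + 2) * (ν + κ) * N q r
      A-w r = begin
        sumFin E (λ c → w c * A k r c)     ≡⟨ A-apply k w r ⟩
        (- + 2) * w r + - sumFin n (λ v → χ k v * N v r * sumFin E (λ c → w c * N v c))
          ≡⟨ cong (λ z → (- + 2) * w r + - z) (trans (sum-cong n inner) (sum-*ˡ n (+ 2) (λ v → χ k v * N v r))) ⟩
        (- + 2) * w r + - (+ 2 * S k r)    ≡⟨ collect (ν + κ) (N q r) (S k r) ⟩
        (- + 2) * (ν + κ) * N q r          ∎
        where
        collect : ∀ x a s → (- + 2) * (x * a + (- + 1) * s) + - (+ 2 * s) ≡ (- + 2) * x * a
        collect = solve-∀
        -- The products `c * d` and `c * c` are kept apart because their next simplifications, χ δ =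
        -- 0 and χ² = χ, are not ring identities.
        expand : ∀ x k c b d →
          c * b * ((x + k) * ((x - + 2) * d + + 1) + (- + 1) * ((x - + 2) * c + k)) ≡
          (x + k) * (x - + 2) * b * (c * d) + x * c * b - (x - + 2) * b * (c * c)
        expand = solve-∀
        reduce : ∀ x k c b → (x + k) * (x - + 2) * b * + 0 + x * c * b - (x - + 2) * b * c ≡ + 2 * (c * b)
        reduce = solve-∀
        -- A marked vertex v differs from q, so its inner product with `w` is (n + k) - (n - 2 + k)
        -- = 2.
        inner : ∀ v → χ k v * N v r * sumFin E (λ c → w c * N v c) ≡ + 2 * (χ k v * N v r)
        inner v = begin
          χ k v * N v r * sumFin E (λ c → w c * N v c)   ≡⟨ cong (χ k v * N v r *_) (w-inner v) ⟩
          χ k v * N v r * ((ν + κ) * ((ν - + 2) * ⟦ q ≟ v ⟧ + + 1) + (- + 1) * ((ν - + 2) * χ k v + κ))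
            ≡⟨ expand ν κ (χ k v) (N v r) ⟦ q ≟ v ⟧ ⟩
          (ν + κ) * (ν - + 2) * N v r * (χ k v * ⟦ q ≟ v ⟧) + ν * χ k v * N v r - (ν - + 2) * N v r * (χ k v * χ k v)
            ≡⟨ cong₂ (λ a b → (ν + κ) * (ν - + 2) * N v r * a + ν * χ k v * N v r - (ν - + 2) * N v r * b) (χ-δ q v) (⟦⟧-idem (toℕ v ℕ.<? k)) ⟩
          (ν + κ) * (ν - + 2) * N v r * + 0 + ν * χ k v * N v r - (ν - + 2) * N v r * χ k v
            ≡⟨ reduce ν κ (χ k v) (N v r) ⟩
          + 2 * (χ k v * N v r) ∎

      A-suc : ∀ r c → A (suc k) r c ≡ A k r c + - (N q r * N q c)
      A-suc r c = begin
        (- + 2) * ⟦ r ≟ c ⟧ + - sumFin n (λ v → χ (suc k) v * N v r * N v c)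
          ≡⟨ cong (λ z → (- + 2) * ⟦ r ≟ c ⟧ + - z) (trans (sum-cong n (λ v → trans (cong (λ z → z * N v r * N v c) (χ-suc q v)) (distrib (χ k v) ⟦ q ≟ v ⟧ (N v r) (N v c)))) (sum-+ n (λ v → χ k v * N v r * N v c) (λ v → ⟦ q ≟ v ⟧ * (N v r * N v c)))) ⟩
        (- + 2) * ⟦ r ≟ c ⟧ + - (sumFin n (λ v → χ k v * N v r * N v c) + sumFin n (λ v → ⟦ q ≟ v ⟧ * (N v r * N v c)))
          ≡⟨ cong (λ z → (- + 2) * ⟦ r ≟ c ⟧ + - (sumFin n (λ v → χ k v * N v r * N v c) + z)) (sum-δ n q (λ v → N v r * N v c)) ⟩
        (- + 2) * ⟦ r ≟ c ⟧ + - (sumFin n (λ v → χ k v * N v r * N v c) + N q r * N q c)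
          ≡⟨ regroup ((- + 2) * ⟦ r ≟ c ⟧) (sumFin n (λ v → χ k v * N v r * N v c)) (N q r * N q c) ⟩
        A k r c + - (N q r * N q c) ∎
        where
        distrib : ∀ a d x y → (a + d) * x * y ≡ a * x * y + d * (x * y)
        distrib = solve-∀
        regroup : ∀ a b c → a + - (b + c) ≡ a + - b + - c
        regroup = solve-∀

      -- Rank-one update with d = -2 (n + k): the inner product of `w` and `N q` is (n + k) (n - 1)
      -- - k, and subtracting it from d gives -n (n + k + 1).
      det-step : + 2 * (ν + κ) * det E (A (suc k)) ≡ ν * (ν + κ + + 1) * det E (A k)
      det-step = negate (+ 2 * (ν + κ)) (det E (A (suc k))) (ν * (ν + κ + + 1)) (det E (A k)) (begin
        - (+ 2 * (ν + κ)) * det E (A (suc k))                                   ≡⟨ cong₂ _*_ (neg ν κ) (det-cong E A-suc) ⟩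
        (- + 2) * (ν + κ) * det E (λ r c → A k r c + - (N q r * N q c))         ≡⟨ det-rank-one-update E (A k) (N q) (N q) w ((- + 2) * (ν + κ)) A-w ⟩
        ((- + 2) * (ν + κ) + - sumFin E (λ c → w c * N q c)) * det E (A k)      ≡⟨ cong (λ z → ((- + 2) * (ν + κ) + - z) * det E (A k)) (trans (w-inner q) at-q) ⟩
        ((- + 2) * (ν + κ) + - ((ν + κ) * ((ν - + 2) * + 1 + + 1) + (- + 1) * ((ν - + 2) * + 0 + κ))) * det E (A k)
                                                                                ≡⟨ cong (_* det E (A k)) (simplify ν κ) ⟩
        - (ν * (ν + κ + + 1)) * det E (A k)                                     ∎)
        where
        neg : ∀ x k → - (+ 2 * (x + k)) ≡ (- + 2) * (x + k)
        neg = solve-∀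
        simplify : ∀ x k → (- + 2) * (x + k) + - ((x + k) * ((x - + 2) * + 1 + + 1) + (- + 1) * ((x - + 2) * + 0 + k)) ≡ - (x * (x + k + + 1))
        simplify = solve-∀
        at-q : (ν + κ) * ((ν - + 2) * ⟦ q ≟ q ⟧ + + 1) + (- + 1) * ((ν - + 2) * χ k q + κ) ≡
               (ν + κ) * ((ν - + 2) * + 1 + + 1) + (- + 1) * ((ν - + 2) * + 0 + κ)
        at-q = cong₂ (λ a b → (ν + κ) * ((ν - + 2) * a + + 1) + (- + 1) * ((ν - + 2) * b + κ))
          (⟦⟧-yes (q ≟ q) refl) (⟦⟧-no (k ℕ.<? k) (ℕₚ.<-irrefl refl))
        negate : ∀ a b c d → - a * b ≡ - c * d → a * b ≡ c * d
        negate a b c d h = trans (lemma a b) (trans (cong -_ h) (sym (lemma c d)))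
          where
          lemma : ∀ a b → a * b ≡ - (- a * b)
          lemma = solve-∀

    -- G is n^(4-n) times the Hessian at the all-ones point.
    G : Matrix E
    G r c = + 4 + (- + 2) * ⟦ r ≟ c ⟧ + - sumFin n (λ v → N v r * N v c)

    module _ (n>0 : 0 ℕ.< n) where

      -- The ratios n (n + j + 1) / (2 (n + j)) for j < k telescope to (n / 2)^k (n + k) / n,
      -- starting from (-2)^E; denominators are cleared.
      det-A : ∀ k → k ℕ.≤ n → (+ 2) ^ k * ν * det E (A k) ≡ (- + 2) ^ E * ν ^ k * (ν + + k)
      det-A zero _ = begin
        + 1 * ν * det E (A 0)                        ≡⟨ cong (+ 1 * ν *_) (trans (det-cong E A-zero) (det-scalar E (- + 2))) ⟩
        + 1 * ν * (- + 2) ^ E                        ≡⟨ reorder ν ((- + 2) ^ E) ⟩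
        (- + 2) ^ E * + 1 * (ν + + 0)                ∎
        where
        reorder : ∀ x y → + 1 * x * y ≡ y * + 1 * (x + + 0)
        reorder = solve-∀
        A-zero : ∀ r c → A 0 r c ≡ (- + 2) * ⟦ r ≟ c ⟧
        A-zero r c = trans (cong (λ z → (- + 2) * ⟦ r ≟ c ⟧ + - z)
          (sum-zero n (λ v → cong (λ z → z * N v r * N v c) (⟦⟧-no (toℕ v ℕ.<? 0) (λ ())))))
          (+-identityʳ ((- + 2) * ⟦ r ≟ c ⟧))
      det-A (suc k) k<n = cancelˡ (ν + + k) ν+k≢0 (begin
        (ν + + k) * ((+ 2) ^ suc k * ν * det E (A (suc k)))         ≡⟨ shuffle₁ ν (+ k) ((+ 2) ^ k) (det E (A (suc k))) ⟩
        (+ 2) ^ k * ν * (+ 2 * (ν + + k) * det E (A (suc k)))       ≡⟨ cong ((+ 2) ^ k * ν *_) next ⟩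
        (+ 2) ^ k * ν * (ν * (ν + + k + + 1) * det E (A k))         ≡⟨ shuffle₂ ν (+ k) ((+ 2) ^ k) (det E (A k)) ⟩
        ν * (ν + + k + + 1) * ((+ 2) ^ k * ν * det E (A k))         ≡⟨ cong (ν * (ν + + k + + 1) *_) (det-A k (ℕₚ.<⇒≤ k<n)) ⟩
        ν * (ν + + k + + 1) * ((- + 2) ^ E * ν ^ k * (ν + + k))     ≡⟨ shuffle₃ ν (+ k) ((- + 2) ^ E) (ν ^ k) ⟩
        (ν + + k) * ((- + 2) ^ E * (ν * ν ^ k) * (ν + (+ 1 + + k))) ∎)
        where
        next : + 2 * (ν + + k) * det E (A (suc k)) ≡ ν * (ν + + k + + 1) * det E (A k)
        next = subst (λ j → + 2 * (ν + + j) * det E (A (suc j)) ≡ ν * (ν + + j + + 1) * det E (A j))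
          (Finₚ.toℕ-fromℕ< k<n) (Step.det-step (fromℕ< k<n))
        ν+k≢0 : ν + + k ≢ + 0
        ν+k≢0 e = pos-≢0 n k n>0 e
        shuffle₁ : ∀ x k p D → (x + k) * (+ 2 * p * x * D) ≡ p * x * (+ 2 * (x + k) * D)
        shuffle₁ = solve-∀
        shuffle₂ : ∀ x k p D → p * x * (x * (x + k + + 1) * D) ≡ x * (x + k + + 1) * (p * x * D)
        shuffle₂ = solve-∀
        shuffle₃ : ∀ x k t p → x * (x + k + + 1) * (t * p * (x + k)) ≡ (x + k) * (t * (x * p) * (x + (+ 1 + k)))
        shuffle₃ = solve-∀

      ν≢0 : ν ≢ + 0
      ν≢0 e = pos-≢0 n 0 n>0 (trans (+-identityʳ ν) e)

      χ-full : ∀ v → χ n v ≡ + 1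
      χ-full v = ⟦⟧-yes (toℕ v ℕ.<? n) (Finₚ.toℕ<n v)

      -- Adding 4 J is the update with u = 1 and v = -4. The all-ones vector is its solution, being
      -- an eigenvector of `A n` with eigenvalue -2 - 2 (n - 1) = -2 n; then d - v · w = -2 n + 4 E,
      -- which is -2 n times -(n - 2).
      det-G-A : det E G ≡ (- (ν - + 2)) * det E (A n)
      det-G-A = cancelˡ ((- + 2) * ν) -2ν≢0 (begin
        (- + 2) * ν * det E G                                             ≡⟨ cong ((- + 2) * ν *_) (det-cong E G-update) ⟩
        (- + 2) * ν * det E (λ r c → A n r c + - (+ 1 * (- + 4)))         ≡⟨ det-rank-one-update E (A n) (λ _ → + 1) (λ _ → - + 4) (λ _ → + 1) ((- + 2) * ν) A-one ⟩
        ((- + 2) * ν + - sumFin E (λ _ → + 1 * (- + 4))) * det E (A n)    ≡⟨ cong (λ z → ((- + 2) * ν + - z) * det E (A n)) (trans (sum-const E (- + 4)) (trans (four (+ E)) (cong ((- + 2) *_) edge-count))) ⟩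
        ((- + 2) * ν + - ((- + 2) * (ν * ν - ν))) * det E (A n)           ≡⟨ collect ν (det E (A n)) ⟩
        (- + 2) * ν * ((- (ν - + 2)) * det E (A n))                       ∎)
        where
        four : ∀ x → x * (- + 4) ≡ (- + 2) * (x * + 2)
        four = solve-∀
        collect : ∀ x D → ((- + 2) * x + - ((- + 2) * (x * x - x))) * D ≡ (- + 2) * x * ((- (x - + 2)) * D)
        collect = solve-∀
        -2ν≢0 : (- + 2) * ν ≢ + 0
        -2ν≢0 e = ν≢0 (cancelˡ (- + 2) (λ ()) e)
        regroup : ∀ a b → + 4 + a + - b ≡ (a + - b) + - (+ 1 * (- + 4))
        regroup = solve-∀
        G-update : ∀ r c → G r c ≡ A n r c + - (+ 1 * (- + 4))
        G-update r c = trans (regroup ((- + 2) * ⟦ r ≟ c ⟧) (sumFin n (λ v → N v r * N v c)))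
          (cong (λ z → (- + 2) * ⟦ r ≟ c ⟧ + - z + - (+ 1 * (- + 4)))
            (sum-cong n (λ v → cong (_* N v c) (trans (sym (*-identityˡ (N v r))) (cong (_* N v r) (sym (χ-full v)))))))
        finish : ∀ x → (- + 2) * + 1 + - (+ 2 * (x - + 1)) ≡ (- + 2) * x * + 1
        finish = solve-∀
        A-one : ∀ r → sumFin E (λ c → + 1 * A n r c) ≡ (- + 2) * ν * + 1
        A-one r = begin
          sumFin E (λ c → + 1 * A n r c)                                                       ≡⟨ A-apply n (λ _ → + 1) r ⟩
          (- + 2) * + 1 + - sumFin n (λ v → χ n v * N v r * sumFin E (λ c → + 1 * N v c))
            ≡⟨ cong (λ z → (- + 2) * + 1 + - z) (sum-cong n (λ v → cong₂ _*_ (trans (cong (_* N v r) (χ-full v)) (*-identityˡ (N v r))) (trans (sum-cong E (λ c → *-identityˡ (N v c))) (N-degree v)))) ⟩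
          (- + 2) * + 1 + - sumFin n (λ v → N v r * (ν - + 1))                                 ≡⟨ cong (λ z → (- + 2) * + 1 + - z) (trans (sum-*ʳ n (λ v → N v r) (ν - + 1)) (cong (_* (ν - + 1)) (N-column r))) ⟩
          (- + 2) * + 1 + - (+ 2 * (ν - + 1))                                                  ≡⟨ finish ν ⟩
          (- + 2) * ν * + 1                                                                    ∎

      det-G : (+ 2) ^ n * det E G ≡ (- + 2) ^ E * ν ^ n * (- (+ 2 * (ν - + 2)))
      det-G = cancelˡ ν ν≢0 (begin
        ν * ((+ 2) ^ n * det E G)                                   ≡⟨ cong (λ z → ν * ((+ 2) ^ n * z)) det-G-A ⟩
        ν * ((+ 2) ^ n * ((- (ν - + 2)) * det E (A n)))             ≡⟨ shuffle₁ ν ((+ 2) ^ n) (det E (A n)) ⟩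
        (- (ν - + 2)) * ((+ 2) ^ n * ν * det E (A n))               ≡⟨ cong ((- (ν - + 2)) *_) (det-A n ℕₚ.≤-refl) ⟩
        -- With all n vertices processed the telescoped numerator n + k is 2 n; its n cancels and
        -- its 2 remains in the result.
        (- (ν - + 2)) * ((- + 2) ^ E * ν ^ n * (ν + ν))             ≡⟨ shuffle₂ ν ((- + 2) ^ E) (ν ^ n) ⟩
        ν * ((- + 2) ^ E * ν ^ n * (- (+ 2 * (ν - + 2))))           ∎)
        where
        shuffle₁ : ∀ x p D → x * (p * ((- (x - + 2)) * D)) ≡ (- (x - + 2)) * (p * x * D)
        shuffle₁ = solve-∀
        shuffle₂ : ∀ x t p → (- (x - + 2)) * (t * p * (x + x)) ≡ x * (t * p * (- (+ 2 * (x - + 2))))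
        shuffle₂ = solve-∀

-- Forests, their components, and the effect of adding an edge.

module ForestComponents where
  open Summation
  open CompleteGraph
  open import Data.Integer using (_+_; _*_)
  open Subsets using (inside; outside; _∈_; _∉_; _⊆_)

  infixl 6 _⊕_ _⊖_
  _⊕_ _⊖_ : ∀ {k} → Subset k → Fin k → Subset k
  F ⊕ f = F [ f ]≔ inside
  F ⊖ f = F [ f ]≔ outside

  module _ {k} {F : Subset k} where

    ∈-update⁻ : ∀ {e f s} → e ≢ f → e ∈ F [ f ]≔ s → e ∈ F
    ∈-update⁻ {e} {f} {s} e≢f h = lookup⇒[]= e F (trans (sym (lookup∘update′ e≢f F s)) ([]=⇒lookup h))

    f∈F⊕f : ∀ f → f ∈ F ⊕ f
    f∈F⊕f f = []≔-updates F f

    F⊆F⊕f : ∀ f → F ⊆ F ⊕ f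
    F⊆F⊕f f {e} e∈F with e ≟ f
    ... | yes refl = f∈F⊕f f
    ... | no e≢f   = []≔-minimal F e f e≢f e∈F

    ∈-⊕⁻ : ∀ {e f} → e ∈ F ⊕ f → e ≡ f ⊎ e ∈ F
    ∈-⊕⁻ {e} {f} h with e ≟ f
    ... | yes e≡f = inj₁ e≡f
    ... | no e≢f  = inj₂ (∈-update⁻ e≢f h)

    ⊕-⊆ : ∀ {f} {T : Subset k} → F ⊆ T → f ∈ T → F ⊕ f ⊆ T
    ⊕-⊆ F⊆T f∈T e∈ with ∈-⊕⁻ e∈
    ... | inj₁ refl = f∈T
    ... | inj₂ e∈F  = F⊆T e∈F

    f∉F⊖f : ∀ f → f ∉ F ⊖ f
    f∉F⊖f f h with trans (sym (lookup∘update f F outside)) ([]=⇒lookup h)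
    ... | ()

    ∈-⊖⁺ : ∀ {e f} → e ∈ F → e ≢ f → e ∈ F ⊖ f
    ∈-⊖⁺ {e} {f} e∈F e≢f = []≔-minimal F e f e≢f e∈F

    ∈-⊖⁻ : ∀ {e f} → e ∈ F ⊖ f → e ≢ f × e ∈ F
    ∈-⊖⁻ {e} {f} h with e ≟ f
    ... | yes refl = ⊥-elim (f∉F⊖f f h)
    ... | no e≢f   = e≢f , ∈-update⁻ e≢f h

  module _ {k} (j : Fin (suc k)) (i : Fin k) where

    -- The quotient map on labels that glues `j` to `punchIn j i` and renumbers the remaining labels
    -- without a gap.
    merge : Fin (suc k) → Fin k
    merge x with j ≟ x
    ... | yes _  = i
    ... | no j≢x = punchOut j≢x

    merge-self : merge j ≡ i
    merge-self with j ≟ j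
    ... | yes _  = refl
    ... | no j≢j = ⊥-elim (j≢j refl)

    merge-punchIn : ∀ y → merge (punchIn j y) ≡ y
    merge-punchIn y with j ≟ punchIn j y
    ... | yes j≡ = ⊥-elim (punchInᵢ≢i j y (sym j≡))
    ... | no j≢  = trans (punchOut-cong j refl) (punchOut-punchIn j)

    data Position (x : Fin (suc k)) : Set where
      removed : x ≡ j → Position x
      kept    : ∀ y → x ≡ punchIn j y → Position x

    position : ∀ x → Position x
    position x with j ≟ x
    ... | yes j≡x = removed (sym j≡x)
    ... | no j≢x  = kept (punchOut j≢x) (sym (punchIn-punchOut j≢x))

    merge-≡ : ∀ x y → merge x ≡ merge y →
      x ≡ y ⊎ (x ≡ j × y ≡ punchIn j i) ⊎ (x ≡ punchIn j i × y ≡ j)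
    merge-≡ x y h with position x | position y
    ... | removed refl | removed refl = inj₁ refl
    ... | removed refl | kept b refl  = inj₂ (inj₁ (refl , cong (punchIn j) (trans (sym (merge-punchIn b)) (trans (sym h) merge-self))))
    ... | kept a refl  | removed refl = inj₂ (inj₂ (cong (punchIn j) (trans (sym (merge-punchIn a)) (trans h merge-self)) , refl))
    ... | kept a refl  | kept b refl  = inj₁ (cong (punchIn j) (trans (sym (merge-punchIn a)) (trans h (merge-punchIn b))))

    merge-fibre : ∀ x y → ⟦ merge x ≟ y ⟧ ≡ ⟦ x ≟ punchIn j y ⟧ + ⟦ i ≟ y ⟧ * ⟦ x ≟ j ⟧
    merge-fibre x y with position x
    ... | removed refl = begin
      ⟦ merge j ≟ y ⟧                                   ≡⟨ cong (λ z → ⟦ z ≟ y ⟧) merge-self ⟩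
      ⟦ i ≟ y ⟧                                         ≡⟨ unit ⟦ i ≟ y ⟧ ⟩
      + 0 + ⟦ i ≟ y ⟧ * + 1                             ≡⟨ sym (cong₂ (λ a b → a + ⟦ i ≟ y ⟧ * b) (⟦⟧-no (j ≟ punchIn j y) (λ e → punchInᵢ≢i j y (sym e))) (⟦⟧-yes (j ≟ j) refl)) ⟩
      ⟦ j ≟ punchIn j y ⟧ + ⟦ i ≟ y ⟧ * ⟦ j ≟ j ⟧       ∎
      where
      unit : ∀ a → a ≡ + 0 + a * + 1
      unit = solve-∀
    ... | kept a refl = begin
      ⟦ merge (punchIn j a) ≟ y ⟧                       ≡⟨ cong (λ z → ⟦ z ≟ y ⟧) (merge-punchIn a) ⟩
      ⟦ a ≟ y ⟧                                         ≡⟨ ⟦⟧-⇔ (a ≟ y) (punchIn j a ≟ punchIn j y) (cong (punchIn j)) (punchIn-injective j a y) ⟩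
      ⟦ punchIn j a ≟ punchIn j y ⟧                     ≡⟨ unit ⟦ punchIn j a ≟ punchIn j y ⟧ ⟦ i ≟ y ⟧ ⟩
      ⟦ punchIn j a ≟ punchIn j y ⟧ + ⟦ i ≟ y ⟧ * + 0   ≡⟨ sym (cong (λ b → ⟦ punchIn j a ≟ punchIn j y ⟧ + ⟦ i ≟ y ⟧ * b) (⟦⟧-no (punchIn j a ≟ j) (punchInᵢ≢i j a))) ⟩
      ⟦ punchIn j a ≟ punchIn j y ⟧ + ⟦ i ≟ y ⟧ * ⟦ punchIn j a ≟ j ⟧ ∎
      where
      unit : ∀ a b → a ≡ a + b * + 0
      unit = solve-∀

  module Fibres {n : ℕ} where

    size : ∀ {k} → (Fin n → Fin k) → Fin k → ℤ
    size c i = sumFin n (λ u → ⟦ c u ≟ i ⟧)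

    sizes : ∀ {k} → (Fin n → Fin k) → ℤ
    sizes {k} c = prodFin k (size c)

    sum-fibres : ∀ {k} (c : Fin n → Fin k) (h : Fin k → ℤ) →
      sumFin n (λ u → h (c u)) ≡ sumFin k (λ i → size c i * h i)
    sum-fibres {k} c h = begin
      sumFin n (λ u → h (c u))                             ≡⟨ sum-cong n (λ u → sym (sum-δ k (c u) h)) ⟩
      sumFin n (λ u → sumFin k (λ i → ⟦ c u ≟ i ⟧ * h i))  ≡⟨ sum-swap n k (λ u i → ⟦ c u ≟ i ⟧ * h i) ⟩
      sumFin k (λ i → sumFin n (λ u → ⟦ c u ≟ i ⟧ * h i))  ≡⟨ sum-cong k (λ i → sum-*ʳ n (λ u → ⟦ c u ≟ i ⟧) (h i)) ⟩
      sumFin k (λ i → size c i * h i)                      ∎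

    sum-size : ∀ {k} (c : Fin n → Fin k) → sumFin k (size c) ≡ + n
    sum-size {k} c = begin
      sumFin k (size c)                 ≡⟨ sum-cong k (λ i → sym (*-identityʳ (size c i))) ⟩
      sumFin k (λ i → size c i * + 1)   ≡⟨ sym (sum-fibres c (λ _ → + 1)) ⟩
      sumFin n (λ _ → + 1)              ≡⟨ trans (sum-const n (+ 1)) (*-identityʳ (+ n)) ⟩
      + n                               ∎

    size-merge : ∀ {k} (c : Fin n → Fin (suc k)) j i y →
      size (λ u → merge j i (c u)) y ≡ size c (punchIn j y) + ⟦ i ≟ y ⟧ * size c j
    size-merge c j i y = begin
      sumFin n (λ u → ⟦ merge j i (c u) ≟ y ⟧)                                  ≡⟨ sum-cong n (λ u → merge-fibre j i (c u) y) ⟩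
      sumFin n (λ u → ⟦ c u ≟ punchIn j y ⟧ + ⟦ i ≟ y ⟧ * ⟦ c u ≟ j ⟧)          ≡⟨ sum-+ n (λ u → ⟦ c u ≟ punchIn j y ⟧) (λ u → ⟦ i ≟ y ⟧ * ⟦ c u ≟ j ⟧) ⟩
      size c (punchIn j y) + sumFin n (λ u → ⟦ i ≟ y ⟧ * ⟦ c u ≟ j ⟧)           ≡⟨ +-congˡ (size c (punchIn j y)) (sum-*ˡ n ⟦ i ≟ y ⟧ (λ u → ⟦ c u ≟ j ⟧)) ⟩
      size c (punchIn j y) + ⟦ i ≟ y ⟧ * size c j                               ∎

    -- Merging replaces the factors a and b of the product by the single factor a + b;
    -- multiplication by a b avoids the quotient.
    sizes-merge : ∀ {k} (c : Fin n → Fin (suc k)) j i →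
      sizes (λ u → merge j i (c u)) * (size c j * size c (punchIn j i)) ≡ sizes c * (size c j + size c (punchIn j i))
    sizes-merge {suc k} c j i = begin
      sizes c′ * (a * b)              ≡⟨ cong (_* (a * b)) (trans (prod-punchIn k i (size c′)) (cong₂ _*_ at-i (prod-cong k off-i))) ⟩
      (b + a) * Q * (a * b)           ≡⟨ shuffle a b Q ⟩
      a * (b * Q) * (a + b)           ≡⟨ cong (_* (a + b)) (sym (trans (prod-punchIn (suc k) j (size c)) (cong (a *_) (prod-punchIn k i (λ y → size c (punchIn j y)))))) ⟩
      sizes c * (a + b)               ∎
      where
      c′ : Fin n → Fin (suc k)
      c′ u = merge j i (c u)
      a = size c j
      b = size c (punchIn j i)
      Q = prodFin k (λ z → size c (punchIn j (punchIn i z)))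
      shuffle : ∀ a b Q → (b + a) * Q * (a * b) ≡ a * (b * Q) * (a + b)
      shuffle = solve-∀
      at-i : size c′ i ≡ b + a
      at-i = trans (size-merge c j i i) (+-congˡ b (trans (cong (_* a) (⟦⟧-yes (i ≟ i) refl)) (*-identityˡ a)))
      off-i : ∀ z → size c′ (punchIn i z) ≡ size c (punchIn j (punchIn i z))
      off-i z = trans (size-merge c j i (punchIn i z)) (trans
        (+-congˡ (size c (punchIn j (punchIn i z))) (trans (cong (_* a) (⟦⟧-no (i ≟ punchIn i z) (λ e → punchInᵢ≢i i z (sym e)))) (*-zeroˡ a)))
        (+-identityʳ (size c (punchIn j (punchIn i z)))))

  module Forests (n : ℕ) where
    open EdgeSums n
    open Fibres {n}

    reach-mono : ∀ {F T u v} → F ⊆ T → Reach n F u v → Reach n T u v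
    reach-mono F⊆T here               = here
    reach-mono F⊆T (step e e∈F adj r) = step e (F⊆T e∈F) adj (reach-mono F⊆T r)

    reach-trans : ∀ {F u v w} → Reach n F u v → Reach n F v w → Reach n F u w
    reach-trans here              s = s
    reach-trans (step e e∈ adj r) s = step e e∈ adj (reach-trans r s)

    reach-sym : ∀ {F u v} → Reach n F u v → Reach n F v u
    reach-sym here                     = here
    reach-sym (step e e∈ (inj₁ adj) r) = reach-trans (reach-sym r) (step e e∈ (inj₂ adj) here)
    reach-sym (step e e∈ (inj₂ adj) r) = reach-trans (reach-sym r) (step e e∈ (inj₁ adj) here)

    reach-edge : ∀ {F e} → e ∈ F → Reach n F (src e) (tgt e)
    reach-edge {e = e} e∈F = step e e∈F (inj₁ refl) here

    -- A walk may use f many times, but a walk that returns across f can be cut short, so at most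
    -- one traversal remains. The hypothesis asks only that each edge of T be f or in F, so that F
    -- may also be a forest with an edge removed.
    reach-split : ∀ {F T f u v} → (∀ {e} → e ∈ T → e ≡ f ⊎ e ∈ F) → Reach n T u v →
      Reach n F u v ⊎ (Reach n F u (src f) × Reach n F (tgt f) v) ⊎ (Reach n F u (tgt f) × Reach n F (src f) v)
    reach-split h here = inj₁ here
    reach-split h (step e e∈T adj r) with h e∈T | reach-split h r
    ... | inj₂ e∈F | inj₁ s               = inj₁ (step e e∈F adj s)
    ... | inj₂ e∈F | inj₂ (inj₁ (s , s′)) = inj₂ (inj₁ (step e e∈F adj s , s′))
    ... | inj₂ e∈F | inj₂ (inj₂ (s , s′)) = inj₂ (inj₂ (step e e∈F adj s , s′))
    reach-split h (step e e∈T (inj₁ refl) r) | inj₁ refl | inj₁ s               = inj₂ (inj₁ (here , s))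
    reach-split h (step e e∈T (inj₁ refl) r) | inj₁ refl | inj₂ (inj₁ (s , s′)) = inj₂ (inj₁ (here , s′))
    reach-split h (step e e∈T (inj₁ refl) r) | inj₁ refl | inj₂ (inj₂ (s , s′)) = inj₁ s′
    reach-split h (step e e∈T (inj₂ refl) r) | inj₁ refl | inj₁ s               = inj₂ (inj₂ (here , s))
    reach-split h (step e e∈T (inj₂ refl) r) | inj₁ refl | inj₂ (inj₁ (s , s′)) = inj₁ s′
    reach-split h (step e e∈T (inj₂ refl) r) | inj₁ refl | inj₂ (inj₂ (s , s′)) = inj₂ (inj₂ (here , s′))

    -- c labels each vertex with its component of F.
    record IsForest {k} (F : Subset E) (c : Fin n → Fin k) : Set where
      field
        sound    : ∀ {u v} → c u ≡ c v → Reach n F u v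
        complete : ∀ {u v} → Reach n F u v → c u ≡ c v
        onto     : ∀ i → ∃ λ u → c u ≡ i
        acyclic  : Acyclic n F

    open IsForest

    -- Symmetric in the labels, since the orientation of an edge by vertex order is unrelated to
    -- them.
    Joins : ∀ {k} → (Fin n → Fin k) → Fin E → Fin k → Fin k → Set
    Joins c f i j = (c (src f) ≡ i × c (tgt f) ≡ j) ⊎ (c (src f) ≡ j × c (tgt f) ≡ i)

    -- The ends of f lie in different components of F, so f connects these two components and no
    -- others, and any cycle through f would have joined its ends already inside F.
    extend : ∀ {k F} {c : Fin n → Fin (suc k)} → IsForest F c → ∀ f j i → Joins c f j (punchIn j i) →
      IsForest (F ⊕ f) (λ u → merge j i (c u))
    extend {k} {F} {c} forest f j i joins = record
      { sound    = λ {u} {v} → sound′ u v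
      ; complete = complete′
      ; onto     = λ y → proj₁ (onto forest (punchIn j y)) , trans (cong (merge j i) (proj₂ (onto forest (punchIn j y)))) (merge-punchIn j i y)
      ; acyclic  = acyclic′
      }
      where
      crossing-if : Joins c f j (punchIn j i) → c (src f) ≢ c (tgt f)
      crossing-if (inj₁ (p , q)) e = punchInᵢ≢i j i (trans (sym q) (trans (sym e) p))
      crossing-if (inj₂ (p , q)) e = punchInᵢ≢i j i (trans (sym p) (trans e q))
      crossing = crossing-if joins
      widen : ∀ {u v} → Reach n F u v → Reach n (F ⊕ f) u v
      widen = reach-mono (F⊆F⊕f f)
      bridge : Joins c f j (punchIn j i) → ∀ u v → c u ≡ j → c v ≡ punchIn j i → Reach n (F ⊕ f) u v
      bridge (inj₁ (a , b)) u v p q =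
        reach-trans (widen (sound forest (trans p (sym a))))
                            (reach-trans (reach-edge (f∈F⊕f f)) (widen (sound forest (trans b (sym q)))))
      bridge (inj₂ (a , b)) u v p q =
        reach-trans (widen (sound forest (trans p (sym b))))
                            (reach-trans (reach-sym (reach-edge (f∈F⊕f f))) (widen (sound forest (trans a (sym q)))))
      sound′ : ∀ u v → merge j i (c u) ≡ merge j i (c v) → Reach n (F ⊕ f) u v
      sound′ u v e with merge-≡ j i (c u) (c v) e
      ... | inj₁ p              = widen (sound forest p)
      ... | inj₂ (inj₁ (p , q)) = bridge joins u v p q
      ... | inj₂ (inj₂ (p , q)) = reach-sym (bridge joins v u q p)
      merged-if : Joins c f j (punchIn j i) → merge j i (c (src f)) ≡ merge j i (c (tgt f))
      merged-if (inj₁ (p , q)) = trans (cong (merge j i) p) (trans (merge-self j i) (sym (trans (cong (merge j i) q) (merge-punchIn j i i))))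
      merged-if (inj₂ (p , q)) = trans (cong (merge j i) p) (trans (merge-punchIn j i i) (sym (trans (cong (merge j i) q) (merge-self j i))))
      merged = merged-if joins
      complete′ : ∀ {u v} → Reach n (F ⊕ f) u v → merge j i (c u) ≡ merge j i (c v)
      complete′ r with reach-split {F = F} ∈-⊕⁻ r
      ... | inj₁ s               = cong (merge j i) (complete forest s)
      ... | inj₂ (inj₁ (s , s′)) = trans (cong (merge j i) (complete forest s)) (trans merged (cong (merge j i) (complete forest s′)))
      ... | inj₂ (inj₂ (s , s′)) = trans (cong (merge j i) (complete forest s)) (trans (sym merged) (cong (merge j i) (complete forest s′)))
      acyclic′ : Acyclic n (F ⊕ f)
      acyclic′ e e∈ r with ∈-⊕⁻ {F = F} e∈
      ... | inj₁ refl = crossing (complete forest (reach-mono shrink r))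
        where
        shrink : (F ⊕ e) ⊖ e ⊆ F
        shrink x∈ with ∈-⊖⁻ {F = F ⊕ e} x∈
        ... | x≢e , x∈F⊕e = ∈-update⁻ x≢e x∈F⊕e
      ... | inj₂ e∈F with reach-split {F = F ⊖ e} {f = f} split r
        where
        split : ∀ {x} → x ∈ (F ⊕ f) ⊖ e → x ≡ f ⊎ x ∈ F ⊖ e
        split x∈ with ∈-⊖⁻ {F = F ⊕ f} x∈
        ... | x≢e , x∈F⊕f with ∈-⊕⁻ {F = F} x∈F⊕f
        ...   | inj₁ x≡f = inj₁ x≡f
        ...   | inj₂ x∈F = inj₂ (∈-⊖⁺ x∈F x≢e)
      ...   | inj₁ s = acyclic forest e e∈F s
      -- A detour around e that passes through f joins each end of f to an end of e within F. As e
      -- belongs to F, both ends of f then lie in one component.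
      ...   | inj₂ (inj₁ (s , s′)) = crossing (trans (sym (class s)) (trans (complete forest (reach-edge e∈F)) (sym (class s′))))
        where
        class : ∀ {u v} → Reach n (F ⊖ e) u v → c u ≡ c v
        class t = complete forest (reach-mono (λ x∈ → proj₂ (∈-⊖⁻ {F = F} x∈)) t)
      ...   | inj₂ (inj₂ (s , s′)) = crossing (trans (class s′) (trans (sym (complete forest (reach-edge e∈F))) (class s)))
        where
        class : ∀ {u v} → Reach n (F ⊖ e) u v → c u ≡ c v
        class t = complete forest (reach-mono (λ x∈ → proj₂ (∈-⊖⁻ {F = F} x∈)) t)

    -- A walk in F between the ends of f avoids f and lies in T, so f would be on a cycle of T.
    tree-edge-crosses : ∀ {F T} → Acyclic n T → F ⊆ T → ∀ f → f ∈ T → f ∉ F → ¬ Reach n F (src f) (tgt f)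
    tree-edge-crosses acyc F⊆T f f∈T f∉F r =
      acyc f f∈T (reach-mono (λ {x} x∈F → ∈-⊖⁺ (F⊆T x∈F) (λ { refl → f∉F x∈F })) r)

    crosses : ∀ {k} → (Fin n → Fin k) → Fin E → ℤ
    crosses c f = ⟦ ¬? (c (src f) ≟ c (tgt f)) ⟧

    -- The label has to change at some edge of the walk if it differs at the two ends.
    crossing-edge : ∀ {k T u v} (c : Fin n → Fin k) → Reach n T u v → c u ≢ c v →
      ∃ λ f → f ∈ T × c (src f) ≢ c (tgt f)
    crossing-edge c here c≢ = ⊥-elim (c≢ refl)
    crossing-edge {u = u} c (step {w = w} e e∈T adj r) c≢ with c u ≟ c w
    ... | yes p = crossing-edge c r (λ q → c≢ (trans p q))
    crossing-edge c (step e e∈T (inj₁ refl) r) c≢ | no p = e , e∈T , p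
    crossing-edge c (step e e∈T (inj₂ refl) r) c≢ | no p = e , e∈T , λ q → p (sym q)

    Fin1-≡ : (x y : Fin 1) → x ≡ y
    Fin1-≡ zero zero = refl

    -- Contracting the k + 1 components of F turns T into a tree on k + 1 vertices, whose k edges
    -- are the crossing edges of T. The induction contracts one such edge `f₀`, which then no longer
    -- crosses.
    crossing-count : ∀ k {F T} (c : Fin n → Fin (suc k)) → IsForest F c → SpanningTree n T → F ⊆ T →
      sumFin E (λ f → ⟦ f ∈? T ⟧ * crosses c f) ≡ + k
    crossing-count zero {T = T} c forest tree F⊆T = sum-zero E λ f →
      trans (cong (⟦ f ∈? T ⟧ *_) (⟦⟧-no (¬? (c (src f) ≟ c (tgt f))) (λ ¬p → ¬p (Fin1-≡ _ _)))) (*-zeroʳ ⟦ f ∈? T ⟧)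
    crossing-count (suc k) {F} {T} c forest tree@(conn , acyc) F⊆T
      with crossing-edge c (conn (proj₁ (onto forest zero)) (proj₁ (onto forest (suc zero))))
             (λ e → 0≢1 (trans (sym (proj₂ (onto forest zero))) (trans e (proj₂ (onto forest (suc zero))))))
      where
      0≢1 : ∀ {k} → zero ≢ Fin.suc (zero {k})
      0≢1 ()
    ... | f₀ , f₀∈T , cross = begin
      sumFin E (λ f → ⟦ f ∈? T ⟧ * crosses c f)                              ≡⟨ sum-cong E pointwise ⟩
      sumFin E (λ f → ⟦ f₀ ≟ f ⟧ + ⟦ f ∈? T ⟧ * crosses c′ f)                ≡⟨ sum-+ E (λ f → ⟦ f₀ ≟ f ⟧) (λ f → ⟦ f ∈? T ⟧ * crosses c′ f) ⟩
      sumFin E (λ f → ⟦ f₀ ≟ f ⟧) + sumFin E (λ f → ⟦ f ∈? T ⟧ * crosses c′ f) ≡⟨ cong₂ _+_ (sum-δ-one E f₀) (crossing-count k c′ forest′ tree F⊕f₀⊆T) ⟩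
      + suc k                                                                ∎
      where
      j = c (src f₀)
      i = punchOut cross
      c′ : Fin n → Fin (suc k)
      c′ u = merge j i (c u)
      forest′ : IsForest (F ⊕ f₀) c′
      forest′ = extend forest f₀ j i (inj₁ (refl , sym (punchIn-punchOut cross)))
      F⊕f₀⊆T : F ⊕ f₀ ⊆ T
      F⊕f₀⊆T = ⊕-⊆ F⊆T f₀∈T
      pointwise : ∀ f → ⟦ f ∈? T ⟧ * crosses c f ≡ ⟦ f₀ ≟ f ⟧ + ⟦ f ∈? T ⟧ * crosses c′ f
      pointwise f with f₀ ≟ f
      ... | yes refl = trans
          (cong₂ _*_ (⟦⟧-yes (f₀ ∈? T) f₀∈T) (⟦⟧-yes (¬? (c (src f₀) ≟ c (tgt f₀))) cross))
          (sym (cong (λ b → + 1 + b) (trans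
            (cong (⟦ f₀ ∈? T ⟧ *_) (⟦⟧-no (¬? (c′ (src f₀) ≟ c′ (tgt f₀))) (λ ¬p → ¬p (complete forest′ (reach-edge (f∈F⊕f f₀))))))
            (*-zeroʳ ⟦ f₀ ∈? T ⟧))))
      -- Any other crossing edge of T still crosses after the merge: otherwise `F ⊕ f₀` would
      -- connect its ends and it would close a cycle in T.
      ... | no f₀≢f = trans
          (⟦⟧-*-cong (f ∈? T) (λ f∈T → ⟦⟧-⇔ (¬? (c (src f) ≟ c (tgt f))) (¬? (c′ (src f) ≟ c′ (tgt f)))
            (λ p q → tree-edge-crosses acyc F⊕f₀⊆T f f∈T (new p) (sound forest′ q))
            (λ p q → p (cong (merge j i) q))))
          (sym (+-identityˡ (⟦ f ∈? T ⟧ * crosses c′ f)))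
        where
        new : c (src f) ≢ c (tgt f) → f ∉ F ⊕ f₀
        new p f∈ with ∈-⊕⁻ {F = F} f∈
        ... | inj₁ f≡f₀ = f₀≢f (sym f≡f₀)
        ... | inj₂ f∈F  = p (complete forest (reach-edge f∈F))

-- The number of spanning trees that contain a given forest.

module TreesContainingForests where
  open Summation
  open CompleteGraph
  open ForestComponents
  open import Data.Integer using (_+_; _*_; _-_; _^_)
  open Subsets using (_⊆_)

  module MergedSizes {n k : ℕ} (c : Fin n → Fin (suc k)) where
    open Fibres {n}

    -- The product of the component sizes after joining components `j` and `i`. The zero diagonal
    -- mirrors `crosses` and allows sums over all pairs of labels.
    mergedSizes : Fin (suc k) → Fin (suc k) → ℤ
    mergedSizes j i with j ≟ i
    ... | yes _  = + 0
    ... | no j≢i = sizes (λ u → merge j (punchOut j≢i) (c u))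

    mergedSizes-diag : ∀ j → mergedSizes j j ≡ + 0
    mergedSizes-diag j with j ≟ j
    ... | yes _  = refl
    ... | no j≢j = ⊥-elim (j≢j refl)

    private
      a : Fin (suc k) → ℤ
      a = size c
      P : ℤ
      P = sizes c

    -- The weight a_j a_i counts the vertex pairs with labels j and i. Off the diagonal
    -- `sizes-merge` applies; on it the left side is zero, and the last term removes the 2 P a_j.
    weighted : ∀ j i → a j * (a i * mergedSizes j i) ≡ P * (a j + a i) + (- + 2) * (⟦ j ≟ i ⟧ * (P * a i))
    weighted j i with j ≟ i
    ... | yes refl = cancel P (a j)
      where
      cancel : ∀ P x → x * (x * + 0) ≡ P * (x + x) + (- + 2) * (+ 1 * (P * x))
      cancel = solve-∀
    ... | no j≢i = begin
      a j * (a i * Q)                          ≡⟨ commute (a j) (a i) Q ⟩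
      Q * (a j * a i)                          ≡⟨ cong (λ z → Q * (a j * a z)) (sym at) ⟩
      Q * (a j * a (punchIn j (punchOut j≢i))) ≡⟨ sizes-merge c j (punchOut j≢i) ⟩
      P * (a j + a (punchIn j (punchOut j≢i))) ≡⟨ cong (λ z → P * (a j + a z)) at ⟩
      P * (a j + a i)                          ≡⟨ unit (P * (a j + a i)) (P * a i) ⟩
      P * (a j + a i) + (- + 2) * (+ 0 * (P * a i)) ∎
      where
      Q = sizes (λ u → merge j (punchOut j≢i) (c u))
      at = punchIn-punchOut j≢i
      commute : ∀ x y q → x * (y * q) ≡ q * (x * y)
      commute = solve-∀
      unit : ∀ x y → x ≡ x + (- + 2) * (+ 0 * y)
      unit = solve-∀

    -- Over ordered pairs of distinct labels each size a_j occurs 2 k times in the sum of a_j + a_i,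
    -- and the sizes add up to n. The sizes thus enter only through their product P, which closes
    -- the induction of the tree count.
    sum-mergedSizes : sumFin n (λ u → sumFin n (λ v → mergedSizes (c u) (c v))) ≡ + 2 * + k * (+ n * P)
    sum-mergedSizes = begin
      sumFin n (λ u → sumFin n (λ v → mergedSizes (c u) (c v)))
        ≡⟨ trans (sum-cong n (λ u → sum-fibres c (mergedSizes (c u)))) (sum-fibres c (λ j → sumFin (suc k) (λ i → a i * mergedSizes j i))) ⟩
      sumFin (suc k) (λ j → a j * sumFin (suc k) (λ i → a i * mergedSizes j i))
        ≡⟨ sum-cong (suc k) row ⟩
      sumFin (suc k) (λ j → (κ - + 2) * P * a j + P * ν * + 1)
        ≡⟨ sum-linear (suc k) ((κ - + 2) * P) (P * ν) a (λ _ → + 1) ⟩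
      (κ - + 2) * P * sumFin (suc k) a + P * ν * sumFin (suc k) (λ _ → + 1)
        ≡⟨ cong₂ (λ x y → (κ - + 2) * P * x + P * ν * y) (sum-size c) (sum-const (suc k) (+ 1)) ⟩
      (κ - + 2) * P * ν + P * ν * (κ * + 1)
        ≡⟨ collect (+ k) P ν ⟩
      + 2 * + k * (ν * P) ∎
      where
      κ ν : ℤ
      κ = + suc k
      ν = + n
      collect : ∀ k P x → (+ 1 + k - + 2) * P * x + P * x * ((+ 1 + k) * + 1) ≡ + 2 * k * (x * P)
      collect = solve-∀
      expand : ∀ P x y d → P * (x + y) + (- + 2) * d ≡ P * x * + 1 + P * y + (- + 2) * d
      expand = solve-∀
      gather : ∀ P x v κ → P * x * (κ * + 1) + P * v + (- + 2) * (P * x) ≡ (κ - + 2) * P * x + P * v * + 1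
      gather = solve-∀
      row : ∀ j → a j * sumFin (suc k) (λ i → a i * mergedSizes j i) ≡ (κ - + 2) * P * a j + P * ν * + 1
      row j = begin
        a j * sumFin (suc k) (λ i → a i * mergedSizes j i)
          ≡⟨ sym (sum-*ˡ (suc k) (a j) (λ i → a i * mergedSizes j i)) ⟩
        sumFin (suc k) (λ i → a j * (a i * mergedSizes j i))
          ≡⟨ sum-cong (suc k) (λ i → trans (weighted j i) (expand P (a j) (a i) (⟦ j ≟ i ⟧ * (P * a i)))) ⟩
        sumFin (suc k) (λ i → P * a j * + 1 + P * a i + (- + 2) * (⟦ j ≟ i ⟧ * (P * a i)))
          ≡⟨ trans (sum-+ (suc k) (λ i → P * a j * + 1 + P * a i) (λ i → (- + 2) * (⟦ j ≟ i ⟧ * (P * a i))))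
               (cong₂ _+_ (sum-linear (suc k) (P * a j) P (λ _ → + 1) a) (sum-*ˡ (suc k) (- + 2) (λ i → ⟦ j ≟ i ⟧ * (P * a i)))) ⟩
        P * a j * sumFin (suc k) (λ _ → + 1) + P * sumFin (suc k) a + (- + 2) * sumFin (suc k) (λ i → ⟦ j ≟ i ⟧ * (P * a i))
          ≡⟨ cong₂ _+_ (cong₂ (λ x y → P * a j * x + P * y) (sum-const (suc k) (+ 1)) (sum-size c)) (cong ((- + 2) *_) (sum-δ (suc k) j (λ i → P * a i))) ⟩
        P * a j * (κ * + 1) + P * ν + (- + 2) * (P * a j)
          ≡⟨ gather P (a j) ν κ ⟩
        (κ - + 2) * P * a j + P * ν * + 1 ∎

  module TreeCount (n : ℕ) {L : ℕ} (T : Fin L → Subset (m n))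
    (T-tree : ∀ t → SpanningTree n (T t))
    (T-injective : ∀ s t → T s ≡ T t → s ≡ t)
    (T-onto : ∀ S → SpanningTree n S → ∃ λ t → T t ≡ S) where
    open EdgeSums n
    open Fibres {n}
    open Forests n
    open IsForest

    count : Subset E → ℤ
    count F = sumFin L (λ t → ⟦ F ⊆? T t ⟧)

    -- A spanning tree that contains another equals it: an additional edge would have its ends
    -- already connected.
    count-tree : ∀ F → SpanningTree n F → count F ≡ + 1
    count-tree F tree@(conn , acyc) with T-onto F tree
    ... | t₀ , refl = trans (sum-cong L (λ t → ⟦⟧-⇔ (F ⊆? T t) (t₀ ≟ t) (equal t) (λ { refl x∈ → x∈ }))) (sum-δ-one L t₀)
      where
      equal : ∀ t → T t₀ ⊆ T t → t₀ ≡ t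
      equal t F⊆T = T-injective t₀ t (⊆-antisym F⊆T T⊆F)
        where
        T⊆F : T t ⊆ T t₀
        T⊆F {f} f∈T with f ∈? T t₀
        ... | yes f∈F = f∈F
        ... | no f∉F  = ⊥-elim (tree-edge-crosses (proj₂ (T-tree t)) F⊆T f f∈T f∉F (conn (src f) (tgt f)))

    -- Double counting of pairs of a tree containing F and a crossing edge f of it: each tree has k
    -- such edges, and for fixed f the trees are those containing `F ⊕ f`.
    count-extend : ∀ k {F} (c : Fin n → Fin (suc k)) → IsForest F c →
      + k * count F ≡ sumFin E (λ f → crosses c f * count (F ⊕ f))
    count-extend k {F} c forest = begin
      + k * count F                                     ≡⟨ sym (sum-*ˡ L (+ k) (λ t → ⟦ F ⊆? T t ⟧)) ⟩
      sumFin L (λ t → + k * ⟦ F ⊆? T t ⟧)               ≡⟨ sum-cong L per-tree ⟩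
      sumFin L (λ t → sumFin E (λ f → crosses c f * ⟦ F ⊕ f ⊆? T t ⟧)) ≡⟨ sum-swap L E (λ t f → crosses c f * ⟦ F ⊕ f ⊆? T t ⟧) ⟩
      sumFin E (λ f → sumFin L (λ t → crosses c f * ⟦ F ⊕ f ⊆? T t ⟧)) ≡⟨ sum-cong E (λ f → sum-*ˡ L (crosses c f) (λ t → ⟦ F ⊕ f ⊆? T t ⟧)) ⟩
      sumFin E (λ f → crosses c f * count (F ⊕ f))      ∎
      where
      rotate : ∀ x y z → x * (y * z) ≡ z * (x * y)
      rotate = solve-∀
      per-tree : ∀ t → + k * ⟦ F ⊆? T t ⟧ ≡ sumFin E (λ f → crosses c f * ⟦ F ⊕ f ⊆? T t ⟧)
      per-tree t = begin
        + k * ⟦ F ⊆? T t ⟧                                               ≡⟨ *-comm (+ k) ⟦ F ⊆? T t ⟧ ⟩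
        ⟦ F ⊆? T t ⟧ * + k                                               ≡⟨ ⟦⟧-*-cong (F ⊆? T t) (λ F⊆T → sym (crossing-count k c forest (T-tree t) F⊆T)) ⟩
        ⟦ F ⊆? T t ⟧ * sumFin E (λ f → ⟦ f ∈? T t ⟧ * crosses c f)       ≡⟨ sym (sum-*ˡ E ⟦ F ⊆? T t ⟧ (λ f → ⟦ f ∈? T t ⟧ * crosses c f)) ⟩
        sumFin E (λ f → ⟦ F ⊆? T t ⟧ * (⟦ f ∈? T t ⟧ * crosses c f))     ≡⟨ sum-cong E (λ f → trans (rotate ⟦ F ⊆? T t ⟧ ⟦ f ∈? T t ⟧ (crosses c f)) (cong (crosses c f *_) (both f))) ⟩
        sumFin E (λ f → crosses c f * ⟦ F ⊕ f ⊆? T t ⟧)                  ∎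
        where
        both : ∀ f → ⟦ F ⊆? T t ⟧ * ⟦ f ∈? T t ⟧ ≡ ⟦ F ⊕ f ⊆? T t ⟧
        both f = ⟦⟧-×-cong (F ⊆? T t) (f ∈? T t) (F ⊕ f ⊆? T t)
          (λ F⊆T f∈T {x} → ⊕-⊆ F⊆T f∈T {x}) (λ sub {x} x∈F → sub (F⊆F⊕f f x∈F)) (λ sub → sub (f∈F⊕f f))

    -- The count is n^(k-1) times the product of the k + 1 sizes. The factor n² keeps the powers
    -- natural even for a single component, where the count 1 is n^(-1) times n.
    count-forest : ∀ k {F} (c : Fin n → Fin (suc k)) → IsForest F c → ν * ν * count F ≡ ν ^ suc k * sizes c
    count-forest zero {F} c forest = begin
      ν * ν * count F       ≡⟨ cong (ν * ν *_) (count-tree F ((λ u v → sound forest (Fin1-≡ (c u) (c v))) , acyclic forest)) ⟩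
      ν * ν * + 1           ≡⟨ regroup ν ⟩
      ν * + 1 * (ν * + 1)   ≡⟨ cong (λ z → ν * + 1 * (z * + 1)) (sym (trans (sym (+-identityʳ (size c zero))) (sum-size c))) ⟩
      ν ^ 1 * sizes c       ∎
      where
      regroup : ∀ x → x * x * + 1 ≡ x * + 1 * (x * + 1)
      regroup = solve-∀
    -- The factor `κ` is the number of crossing edges in each tree; the factor 2 pays for summing
    -- over ordered instead of unordered pairs.
    count-forest (suc k) {F} c forest = cancelˡ (+ 2 * κ) (λ ()) (begin
      + 2 * κ * (ν * ν * count F)                                       ≡⟨ shuffle κ ν (count F) ⟩
      + 2 * (ν * ν) * (κ * count F)                                     ≡⟨ cong (+ 2 * (ν * ν) *_) (count-extend (suc k) c forest) ⟩
      + 2 * (ν * ν) * sumFin E (λ f → crosses c f * count (F ⊕ f))      ≡⟨ sym (sum-*ˡ E (+ 2 * (ν * ν)) (λ f → crosses c f * count (F ⊕ f))) ⟩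
      -- One copy of each term is read along f with label order (source, target), the other against
      -- it; together they form the summand of `sum-edges-sym`.
      sumFin E (λ f → + 2 * (ν * ν) * (crosses c f * count (F ⊕ f)))    ≡⟨ sum-cong E (λ f → trans (double (ν * ν) (crosses c f * count (F ⊕ f))) (trans (cong₂ _+_ (forward f) (backward f)) (factor (ν ^ suc k) (g (src f) (tgt f)) (g (tgt f) (src f))))) ⟩
      sumFin E (λ f → ν ^ suc k * (g (src f) (tgt f) + g (tgt f) (src f))) ≡⟨ sum-*ˡ E (ν ^ suc k) (λ f → g (src f) (tgt f) + g (tgt f) (src f)) ⟩
      ν ^ suc k * edges                                                 ≡⟨ cong (ν ^ suc k *_) (trans (sym (+-identityʳ edges)) (trans (+-congˡ edges (sym (sum-zero n (λ u → mergedSizes-diag (c u))))) (trans (sum-edges-sym g) sum-mergedSizes))) ⟩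
      ν ^ suc k * (+ 2 * κ * (ν * sizes c))                             ≡⟨ finish (ν ^ suc k) κ ν (sizes c) ⟩
      + 2 * κ * (ν * ν ^ suc k * sizes c)                               ∎)
      where
      open MergedSizes c
      κ : ℤ
      κ = + suc k
      g : Fin n → Fin n → ℤ
      g u v = mergedSizes (c u) (c v)
      edges = sumFin E (λ f → g (src f) (tgt f) + g (tgt f) (src f))
      shuffle : ∀ k x y → + 2 * k * (x * x * y) ≡ + 2 * (x * x) * (k * y)
      shuffle = solve-∀
      double : ∀ x y → + 2 * x * y ≡ x * y + x * y
      double = solve-∀
      factor : ∀ p x y → p * x + p * y ≡ p * (x + y)
      factor = solve-∀
      finish : ∀ p k x s → p * (+ 2 * k * (x * s)) ≡ + 2 * k * (x * p * s)
      finish = solve-∀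
      absent : ∀ f → c (src f) ≡ c (tgt f) → ν * ν * (crosses c f * count (F ⊕ f)) ≡ ν ^ suc k * + 0
      absent f e = trans (cong (λ z → ν * ν * (z * count (F ⊕ f))) (⟦⟧-no (¬? (c (src f) ≟ c (tgt f))) (λ p → p e))) (vanish ν (count (F ⊕ f)) (ν ^ suc k))
        where
        vanish : ∀ x y p → x * x * (+ 0 * y) ≡ p * + 0
        vanish = solve-∀
      present : ∀ f j i → c (src f) ≢ c (tgt f) → Joins c f j (punchIn j i) →
        ν * ν * (crosses c f * count (F ⊕ f)) ≡ ν ^ suc k * sizes (λ u → merge j i (c u))
      present f j i p joins = trans
        (cong (ν * ν *_) (trans (cong (_* count (F ⊕ f)) (⟦⟧-yes (¬? (c (src f) ≟ c (tgt f))) p)) (*-identityˡ (count (F ⊕ f)))))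
        (count-forest k (λ u → merge j i (c u)) (extend forest f j i joins))
      forward : ∀ f → ν * ν * (crosses c f * count (F ⊕ f)) ≡ ν ^ suc k * g (src f) (tgt f)
      forward f with c (src f) ≟ c (tgt f) in eq
      ... | yes e = trans (cong (λ d → ν * ν * (⟦ ¬? d ⟧ * count (F ⊕ f))) (sym eq)) (absent f e)
      ... | no p  = trans (cong (λ d → ν * ν * (⟦ ¬? d ⟧ * count (F ⊕ f))) (sym eq)) (present f (c (src f)) (punchOut p) p (inj₁ (refl , sym (punchIn-punchOut p))))
      backward : ∀ f → ν * ν * (crosses c f * count (F ⊕ f)) ≡ ν ^ suc k * g (tgt f) (src f)
      backward f with c (tgt f) ≟ c (src f)
      ... | yes e = absent f (sym e)
      ... | no p  = present f (c (tgt f)) (punchOut p) (λ e → p (sym e)) (inj₂ (sym (punchIn-punchOut p) , refl))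

-- The entries of the Hessian at the all-ones point.

module HessianEntries where
  open Summation
  open CompleteGraph
  open IncidenceSpectrum
  open ForestComponents
  open TreesContainingForests
  open import Data.Nat using (_∸_)
  open import Data.Integer using (_+_; _*_; _^_)
  open Subsets using () renaming (⊥ to ∅)

  +ind : ∀ {k} (T : Subset k) e → + ind T e ≡ ⟦ e ∈? T ⟧
  +ind T e with e ∈? T
  ... | yes _ = refl
  ... | no _  = refl

  module _ (n : ℕ) (Ts : List (Subset (m n))) where
    open EdgeSums n

    -- At the all-ones point a monomial has its coefficient as value, so only the exponents brought
    -- down by the two derivatives remain.
    hessian1-sum : ∀ e f → hessian1 n Ts e f ≡
      sumFin (length Ts) (λ t → + 1 * + ind (lookup Ts t) f * + (if does (e ≟ f) then ind (lookup Ts t) e ∸ 1 else ind (lookup Ts t) e))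
    hessian1-sum e f = go Ts
      where
      value : Subset E → ℤ
      value T = + 1 * + ind T f * + (if does (e ≟ f) then ind T e ∸ 1 else ind T e)
      go : ∀ Ts → hessian1 n Ts e f ≡ sumList value Ts
      go []       = refl
      go (T ∷ Ts) = cong₂ _+_ (trans (cong (value T *_) (prod-one E {λ x → (+ 1) ^ power x} (λ x → ^-zeroˡ (power x)))) (*-identityʳ (value T))) (go Ts)
        where
        power₁ power : Fin E → ℕ
        power₁ x = if does (x ≟ f) then ind T x ∸ 1 else ind T x
        power x  = if does (x ≟ e) then power₁ x ∸ 1 else power₁ x

    -- The Kirchhoff polynomial has degree at most one in each variable: the second derivative
    -- brings down the exponent 1 - 1 or 0.
    hessian1-diag : ∀ e → hessian1 n Ts e e ≡ + 0
    hessian1-diag e = trans (hessian1-sum e e) (sum-zero (length Ts) (λ t → vanish (lookup Ts t)))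
      where
      vanish : ∀ T → + 1 * + ind T e * + (if does (e ≟ e) then ind T e ∸ 1 else ind T e) ≡ + 0
      vanish T rewrite dec-true (e ≟ e) refl with e ∈? T
      ... | yes _ = refl
      ... | no _  = refl

    -- The monomial of a tree survives both derivatives, with coefficient 1, exactly when the tree
    -- contains e and f.
    hessian1-off : ∀ e f → e ≢ f → hessian1 n Ts e f ≡ sumFin (length Ts) (λ t → ⟦ ∅ ⊕ e ⊕ f ⊆? lookup Ts t ⟧)
    hessian1-off e f e≢f = trans (hessian1-sum e f) (sum-cong (length Ts) (λ t → entry (lookup Ts t)))
      where
      entry : ∀ T → + 1 * + ind T f * + (if does (e ≟ f) then ind T e ∸ 1 else ind T e) ≡ ⟦ ∅ ⊕ e ⊕ f ⊆? T ⟧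
      entry T rewrite dec-false (e ≟ f) e≢f = begin
        + 1 * + ind T f * + ind T e        ≡⟨ cong (_* + ind T e) (*-identityˡ (+ ind T f)) ⟩
        + ind T f * + ind T e              ≡⟨ cong₂ _*_ (+ind T f) (+ind T e) ⟩
        ⟦ f ∈? T ⟧ * ⟦ e ∈? T ⟧            ≡⟨ ⟦⟧-×-cong (f ∈? T) (e ∈? T) (∅ ⊕ e ⊕ f ⊆? T)
          (λ f∈T e∈T {x} → ⊕-⊆ (⊕-⊆ {F = ∅} ⊥⊆ e∈T) f∈T {x})
          (λ sub → sub (f∈F⊕f f)) (λ sub → sub (F⊆F⊕f f (f∈F⊕f e))) ⟩
        ⟦ ∅ ⊕ e ⊕ f ⊆? T ⟧                 ∎

  -- Used with x and y telling which ends of an edge f lie on e, and P the product of the component sizes of {e, f}.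
  four-minus : ∀ P {x y} → (x ≡ + 0 ⊎ x ≡ + 1) → (y ≡ + 0 ⊎ y ≡ + 1) → ¬ (x ≡ + 1 × y ≡ + 1) →
    P * ((+ 1 + x) * (+ 1 + y)) ≡ + 2 * ((+ 1 + x) + (+ 1 + y)) → P ≡ + 4 + - (x + y)
  four-minus P (inj₁ refl) (inj₁ refl) _  h = trans (sym (*-identityʳ P)) h
  four-minus P (inj₁ refl) (inj₂ refl) _  h = cancelˡ (+ 2) (λ ()) (trans (*-comm (+ 2) P) h)
  four-minus P (inj₂ refl) (inj₁ refl) _  h = cancelˡ (+ 2) (λ ()) (trans (*-comm (+ 2) P) h)
  four-minus P (inj₂ refl) (inj₂ refl) ¬b h = ⊥-elim (¬b (refl , refl))

  module TwoEdges (n p : ℕ) (n≡3+p : n ≡ 3 ℕ.+ p) where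
    open EdgeSums n
    open Fibres {n}
    open Forests n
    open Spectrum n using (G)

    -- Labels of the edgeless forest, one component per vertex. Writing n as 3 + p leaves `suc p`
    -- labels after two merges, the form `count-forest` asks for.
    c₀ : Fin n → Fin (3 ℕ.+ p)
    c₀ = Fin.cast n≡3+p

    c₀⁻¹ : Fin (3 ℕ.+ p) → Fin n
    c₀⁻¹ = Fin.cast (sym n≡3+p)

    c₀-c₀⁻¹ : ∀ i → c₀ (c₀⁻¹ i) ≡ i
    c₀-c₀⁻¹ i = Finₚ.cast-involutive n≡3+p (sym n≡3+p) i

    c₀⁻¹-c₀ : ∀ u → c₀⁻¹ (c₀ u) ≡ u
    c₀⁻¹-c₀ u = Finₚ.cast-involutive (sym n≡3+p) n≡3+p u

    c₀-injective : ∀ {u v} → c₀ u ≡ c₀ v → u ≡ v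
    c₀-injective {u} {v} h = trans (sym (c₀⁻¹-c₀ u)) (trans (cong c₀⁻¹ h) (c₀⁻¹-c₀ v))

    empty-forest : IsForest ∅ c₀
    empty-forest = record
      { sound    = λ h → subst (Reach n ∅ _) (c₀-injective h) here
      ; complete = λ r → cong c₀ (no-step r)
      ; onto     = λ i → c₀⁻¹ i , c₀-c₀⁻¹ i
      ; acyclic  = λ e e∈∅ _ → ∉⊥ e∈∅
      }
      where
      no-step : ∀ {u v} → Reach n ∅ u v → u ≡ v
      no-step here              = refl
      no-step (step e e∈∅ _ _) = ⊥-elim (∉⊥ e∈∅)

    size-c₀ : ∀ i → size c₀ i ≡ + 1
    size-c₀ i = trans (sum-cong n (λ u → ⟦⟧-⇔ (c₀ u ≟ i) (c₀⁻¹ i ≟ u)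
      (λ h → trans (cong c₀⁻¹ (sym h)) (c₀⁻¹-c₀ u)) (λ h → trans (cong c₀ (sym h)) (c₀-c₀⁻¹ i)))) (sum-δ-one n (c₀⁻¹ i))

    N-incident : ∀ w e → N w e ≡ + 1 → w ≡ src e ⊎ w ≡ tgt e
    N-incident w e h with w ≟ src e | w ≟ tgt e
    ... | yes a | _     = inj₁ a
    ... | no _  | yes b = inj₂ b
    N-incident w e () | no _ | no _

    N-0∨1 : ∀ w e → N w e ≡ + 0 ⊎ N w e ≡ + 1
    N-0∨1 w e with w ≟ src e | w ≟ tgt e
    ... | yes a | yes b = ⊥-elim (src≢tgt e (trans (sym a) b))
    ... | yes _ | no _  = inj₂ refl
    ... | no _  | yes _ = inj₂ refl
    ... | no _  | no _  = inj₁ refl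

    -- This entry of Nᵀ N is |e ∩ f|. Written through the ends of f it can be compared with the
    -- component sizes that f joins.
    N-inner-vertices : ∀ e f → sumFin n (λ v → N v e * N v f) ≡ N (src f) e + N (tgt f) e
    N-inner-vertices e f = begin
      sumFin n (λ v → N v e * N v f)                                             ≡⟨ sum-cong n (λ v → trans (distrib (N v e) ⟦ v ≟ src f ⟧ ⟦ v ≟ tgt f ⟧) (cong₂ (λ a b → a * N v e + b * N v e) (δ-sym v (src f)) (δ-sym v (tgt f)))) ⟩
      sumFin n (λ v → ⟦ src f ≟ v ⟧ * N v e + ⟦ tgt f ≟ v ⟧ * N v e)             ≡⟨ sum-+ n (λ v → ⟦ src f ≟ v ⟧ * N v e) (λ v → ⟦ tgt f ≟ v ⟧ * N v e) ⟩
      sumFin n (λ v → ⟦ src f ≟ v ⟧ * N v e) + sumFin n (λ v → ⟦ tgt f ≟ v ⟧ * N v e) ≡⟨ cong₂ _+_ (sum-δ n (src f) (λ v → N v e)) (sum-δ n (tgt f) (λ v → N v e)) ⟩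
      N (src f) e + N (tgt f) e                                                  ∎
      where
      distrib : ∀ x a b → x * (a + b) ≡ a * x + b * x
      distrib = solve-∀

    module _ (e f : Fin E) (e≢f : e ≢ f) where

      private
        separate : c₀ (src e) ≢ c₀ (tgt e)
        separate h = src≢tgt e (c₀-injective h)
        j = c₀ (src e)
        i = punchOut separate
        c₁ : Fin n → Fin (2 ℕ.+ p)
        c₁ u = merge j i (c₀ u)

        at-i : punchIn j i ≡ c₀ (tgt e)
        at-i = punchIn-punchOut separate

        forest₁ : IsForest (∅ ⊕ e) c₁
        forest₁ = extend empty-forest e j i (inj₁ (refl , sym at-i))

        sizes-c₁ : sizes c₁ ≡ + 2
        sizes-c₁ = begin
          sizes c₁                                                          ≡⟨ sym (*-identityʳ (sizes c₁)) ⟩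
          sizes c₁ * (+ 1 * + 1)                                            ≡⟨ sym (cong₂ (λ a b → sizes c₁ * (a * b)) (size-c₀ j) (size-c₀ (punchIn j i))) ⟩
          sizes c₁ * (size c₀ j * size c₀ (punchIn j i))      ≡⟨ sizes-merge c₀ j i ⟩
          sizes c₀ * (size c₀ j + size c₀ (punchIn j i)) ≡⟨ cong₂ _*_ (prod-one (3 ℕ.+ p) size-c₀) (cong₂ _+_ (size-c₀ j) (size-c₀ (punchIn j i))) ⟩
          + 2                                                               ∎

        -- In the forest with the single edge e, the two ends of e share a component and every other
        -- vertex is alone.
        size-c₁ : ∀ w → size c₁ (c₁ w) ≡ + 1 + N w e
        size-c₁ w = begin
          size c₁ (c₁ w)                                                            ≡⟨ size-merge c₀ j i (c₁ w) ⟩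
          size c₀ (punchIn j (c₁ w)) + ⟦ i ≟ c₁ w ⟧ * size c₀ j       ≡⟨ cong₂ (λ a b → a + ⟦ i ≟ c₁ w ⟧ * b) (size-c₀ (punchIn j (c₁ w))) (size-c₀ j) ⟩
          + 1 + ⟦ i ≟ c₁ w ⟧ * + 1                                                  ≡⟨ cong (λ z → + 1 + z) (trans (*-identityʳ ⟦ i ≟ c₁ w ⟧) (δ-sym i (c₁ w))) ⟩
          + 1 + ⟦ c₁ w ≟ i ⟧                                              ≡⟨ cong (λ z → + 1 + z) (merge-fibre j i (c₀ w) i) ⟩
          + 1 + (⟦ c₀ w ≟ punchIn j i ⟧ + ⟦ i ≟ i ⟧ * ⟦ c₀ w ≟ j ⟧)       ≡⟨ cong₂ (λ a b → + 1 + (⟦ c₀ w ≟ a ⟧ + b * ⟦ c₀ w ≟ j ⟧)) at-i (⟦⟧-yes (i ≟ i) refl) ⟩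
          + 1 + (⟦ c₀ w ≟ c₀ (tgt e) ⟧ + + 1 * ⟦ c₀ w ≟ c₀ (src e) ⟧)     ≡⟨ cong₂ (λ a b → + 1 + (a + + 1 * b)) (same w (tgt e)) (same w (src e)) ⟩
          + 1 + (⟦ w ≟ tgt e ⟧ + + 1 * ⟦ w ≟ src e ⟧)                     ≡⟨ cong (λ z → + 1 + z) (flip ⟦ w ≟ tgt e ⟧ ⟦ w ≟ src e ⟧) ⟩
          + 1 + N w e                                                     ∎
          where
          flip : ∀ a b → a + + 1 * b ≡ b + a
          flip = solve-∀
          same : ∀ u v → ⟦ c₀ u ≟ c₀ v ⟧ ≡ ⟦ u ≟ v ⟧
          same u v = ⟦⟧-⇔ (c₀ u ≟ c₀ v) (u ≟ v) c₀-injective (cong c₀)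

        different : ¬ (src f ≡ src e × tgt f ≡ tgt e)
        different (a , b) = e≢f (ends-injective e f (sym a) (sym b))

        not-reversed : ¬ (src f ≡ tgt e × tgt f ≡ src e)
        not-reversed (a , b) = Finₚ.<-asym (src<tgt e) (subst (Fin._< src e) a (subst (src f Fin.<_) b (src<tgt f)))

        crossing : c₁ (src f) ≢ c₁ (tgt f)
        crossing h with merge-≡ j i (c₀ (src f)) (c₀ (tgt f)) h
        ... | inj₁ a              = src≢tgt f (c₀-injective a)
        ... | inj₂ (inj₁ (a , b)) = different (c₀-injective a , c₀-injective (trans b at-i))
        ... | inj₂ (inj₂ (a , b)) = not-reversed (c₀-injective (trans a at-i) , c₀-injective b)

        not-both : ¬ (N (src f) e ≡ + 1 × N (tgt f) e ≡ + 1)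
        not-both (a , b) with N-incident (src f) e a | N-incident (tgt f) e b
        ... | inj₁ x | inj₁ y = src≢tgt f (trans x (sym y))
        ... | inj₁ x | inj₂ y = different (x , y)
        ... | inj₂ x | inj₁ y = not-reversed (x , y)
        ... | inj₂ x | inj₂ y = src≢tgt f (trans x (sym y))

      two-edge-labels : Fin n → Fin (suc p)
      two-edge-labels u = merge (c₁ (src f)) (punchOut crossing) (c₁ u)

      two-edge-forest : IsForest (∅ ⊕ e ⊕ f) two-edge-labels
      two-edge-forest = extend forest₁ f (c₁ (src f)) (punchOut crossing) (inj₁ (refl , sym (punchIn-punchOut crossing)))

      -- Apart from ones the component sizes are 2 and 2 for disjoint edges and 3 for edges with a
      -- common vertex, so the product is 4 - |e ∩ f|.
      two-edge-sizes : sizes two-edge-labels ≡ G e f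
      two-edge-sizes = begin
        sizes two-edge-labels                           ≡⟨ four-minus (sizes two-edge-labels) (N-0∨1 (src f) e) (N-0∨1 (tgt f) e) not-both product ⟩
        + 4 + - (N (src f) e + N (tgt f) e)             ≡⟨ sym (cong₂ (λ a b → + 4 + (- + 2) * a + - b) (⟦⟧-no (e ≟ f) e≢f) (N-inner-vertices e f)) ⟩
        G e f                                           ∎
        where
        product : sizes two-edge-labels * ((+ 1 + N (src f) e) * (+ 1 + N (tgt f) e)) ≡ + 2 * ((+ 1 + N (src f) e) + (+ 1 + N (tgt f) e))
        product = begin
          sizes two-edge-labels * ((+ 1 + N (src f) e) * (+ 1 + N (tgt f) e))
            ≡⟨ sym (cong₂ (λ a b → sizes two-edge-labels * (a * b)) (size-c₁ (src f)) (trans (cong (size c₁) (punchIn-punchOut crossing)) (size-c₁ (tgt f)))) ⟩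
          sizes two-edge-labels * (size c₁ (c₁ (src f)) * size c₁ (punchIn (c₁ (src f)) (punchOut crossing)))
            ≡⟨ sizes-merge c₁ (c₁ (src f)) (punchOut crossing) ⟩
          sizes c₁ * (size c₁ (c₁ (src f)) + size c₁ (punchIn (c₁ (src f)) (punchOut crossing)))
            ≡⟨ cong₂ _*_ sizes-c₁ (cong₂ _+_ (size-c₁ (src f)) (trans (cong (size c₁) (punchIn-punchOut crossing)) (size-c₁ (tgt f)))) ⟩
          + 2 * ((+ 1 + N (src f) e) + (+ 1 + N (tgt f) e)) ∎

    -- The diagonal of Nᵀ N is 2, so 4 - 2 - 2 = 0: the term -2 I is what makes the off-diagonal
    -- formula valid on the diagonal too.
    G-diag : ∀ e → G e e ≡ + 0
    G-diag e = cong₂ (λ a b → + 4 + (- + 2) * a + - b) (⟦⟧-yes (e ≟ e) refl) (trans (N-inner-vertices e e) (cong₂ _+_ at-src at-tgt))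
      where
      at-src : N (src e) e ≡ + 1
      at-src = cong₂ _+_ (⟦⟧-yes (src e ≟ src e) refl) (⟦⟧-no (src e ≟ tgt e) (src≢tgt e))
      at-tgt : N (tgt e) e ≡ + 1
      at-tgt = cong₂ _+_ (⟦⟧-no (tgt e ≟ src e) (λ h → src≢tgt e (sym h))) (⟦⟧-yes (tgt e ≟ tgt e) refl)

    module _ (Ts : List (Subset E)) (Ts! : Unique Ts) (Ts-trees : ∀ T → (T List.∈ Ts) ⇔ SpanningTree n T) where

      private
        listed-tree : ∀ t → SpanningTree n (lookup Ts t)
        listed-tree t = Equivalence.to (Ts-trees (lookup Ts t)) (∈-lookup t)

        position-of : ∀ S → SpanningTree n S → ∃ λ t → lookup Ts t ≡ S
        position-of S tree = index S∈Ts , sym (lookup-index S∈Ts)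
          where S∈Ts = Equivalence.from (Ts-trees S) tree

      open TreeCount n (lookup Ts) listed-tree (lookup-injective Ts!) position-of

      -- The forest of e and f has p + 1 = n - 2 components, which gives the power n^(n-4);
      -- multiplication by n² includes n = 3, where the exponent is negative.
      hessian1-entry : ∀ e f → ν * ν * hessian1 n Ts e f ≡ ν ^ suc p * G e f
      hessian1-entry e f = by-cases (e ≟ f)
        where
        by-cases : Dec (e ≡ f) → ν * ν * hessian1 n Ts e f ≡ ν ^ suc p * G e f
        by-cases (yes refl) = begin
          ν * ν * hessian1 n Ts e e   ≡⟨ cong (ν * ν *_) (hessian1-diag n Ts e) ⟩
          ν * ν * + 0                 ≡⟨ trans (*-zeroʳ (ν * ν)) (sym (*-zeroʳ (ν ^ suc p))) ⟩
          ν ^ suc p * + 0             ≡⟨ cong (ν ^ suc p *_) (sym (G-diag e)) ⟩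
          ν ^ suc p * G e e           ∎
        by-cases (no e≢f) = begin
          ν * ν * hessian1 n Ts e f                   ≡⟨ cong (ν * ν *_) (hessian1-off n Ts e f e≢f) ⟩
          ν * ν * count (∅ ⊕ e ⊕ f)                   ≡⟨ count-forest p (two-edge-labels e f e≢f) (two-edge-forest e f e≢f) ⟩
          ν ^ suc p * sizes (two-edge-labels e f e≢f) ≡⟨ cong (ν ^ suc p *_) (two-edge-sizes e f e≢f) ⟩
          ν ^ suc p * G e f                           ∎

-- Comparison of signs and exponents with the closed formula.

module HessianDeterminant where
  open Summation
  open Determinants
  open CompleteGraph
  open IncidenceSpectrum
  open HessianEntries
  open import Data.Nat using (_∸_)
  open import Data.Integer using (_+_; _*_; _-_; _^_)

  nC2-suc : ∀ n → suc n C 2 ≡ n ℕ.+ n C 2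
  nC2-suc n = trans (sym (nCk+nC[k+1]≡[n+1]C[k+1] n 1)) (cong (ℕ._+ n C 2) (nC1≡n n))

  2*nC2 : ∀ n → + (n C 2) * + 2 ≡ + n * + n - + n
  2*nC2 zero    = refl
  2*nC2 (suc n) = begin
    + (suc n C 2) * + 2                   ≡⟨ cong (λ z → + z * + 2) (nC2-suc n) ⟩
    (+ n + + (n C 2)) * + 2               ≡⟨ distrib (+ n) (+ (n C 2)) ⟩
    + n * + 2 + + (n C 2) * + 2           ≡⟨ cong (λ z → + n * + 2 + z) (2*nC2 n) ⟩
    + n * + 2 + (+ n * + n - + n)         ≡⟨ collect (+ n) ⟩
    (+ 1 + + n) * (+ 1 + + n) - (+ 1 + + n) ∎
    where
    distrib : ∀ a b → (a + b) * + 2 ≡ a * + 2 + b * + 2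
    distrib = solve-∀
    collect : ∀ x → x * + 2 + (x * x - x) ≡ (+ 1 + x) * (+ 1 + x) - (+ 1 + x)
    collect = solve-∀

  m≡nC2 : ∀ n → m n ≡ n C 2
  m≡nC2 n = +-injective (cancelˡ (+ 2) (λ ()) (begin
    + 2 * + m n        ≡⟨ *-comm (+ 2) (+ m n) ⟩
    + m n * + 2        ≡⟨ trans (EdgeSums.edge-count n) (sym (2*nC2 n)) ⟩
    + (n C 2) * + 2    ≡⟨ *-comm (+ (n C 2)) (+ 2) ⟩
    + 2 * + (n C 2)    ∎))

  [-2]^ : ∀ k → (- + 2) ^ k ≡ (- + 1) ^ k * (+ 2) ^ k
  [-2]^ zero    = refl
  [-2]^ (suc k) = trans (cong ((- + 2) *_) ([-2]^ k)) (shuffle ((- + 1) ^ k) ((+ 2) ^ k))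
    where
    shuffle : ∀ a b → (- + 2) * (a * b) ≡ (- + 1) * a * (+ 2 * b)
    shuffle = solve-∀

  -- At n = 3 the exponent n + C(n,2)(n - 4) only vanishes because C(3,2) = 3.
  ^-exponent : ∀ p c x → (p ≡ 0 → c ≡ 3) →
    x ^ ((3 ℕ.+ p ℕ.+ c ℕ.* (3 ℕ.+ p ∸ 4)) ∸ c ℕ.* (4 ∸ (3 ℕ.+ p))) * (x * x) ^ c ≡ x ^ (3 ℕ.+ p) * (x ^ suc p) ^ c
  ^-exponent zero c x h rewrite h refl = cube x
    where
    cube : ∀ x → + 1 * ((x * x) * ((x * x) * ((x * x) * + 1))) ≡ (x * (x * (x * + 1))) * ((x * + 1) * ((x * + 1) * ((x * + 1) * + 1)))
    cube = solve-∀
  ^-exponent (suc q) c x _ = begin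
    x ^ ((4 ℕ.+ q ℕ.+ c ℕ.* q) ∸ c ℕ.* (0 ∸ q)) * (x * x) ^ c ≡⟨ cong₂ (λ k y → x ^ ((4 ℕ.+ q ℕ.+ c ℕ.* q) ∸ k) * (x * y) ^ c) (trans (cong (c ℕ.*_) (ℕₚ.0∸n≡0 q)) (ℕₚ.*-zeroʳ c)) (sym (*-identityʳ x)) ⟩
    x ^ (4 ℕ.+ q ℕ.+ c ℕ.* q) * (x ^ 2) ^ c                ≡⟨ cong (x ^ (4 ℕ.+ q ℕ.+ c ℕ.* q) *_) (^-*-assoc x 2 c) ⟩
    x ^ (4 ℕ.+ q ℕ.+ c ℕ.* q) * x ^ (2 ℕ.* c)              ≡⟨ sym (^-distribˡ-+-* x (4 ℕ.+ q ℕ.+ c ℕ.* q) (2 ℕ.* c)) ⟩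
    x ^ (4 ℕ.+ q ℕ.+ c ℕ.* q ℕ.+ 2 ℕ.* c)                  ≡⟨ cong (x ^_) exponents ⟩
    x ^ (4 ℕ.+ q ℕ.+ (2 ℕ.+ q) ℕ.* c)                      ≡⟨ ^-distribˡ-+-* x (4 ℕ.+ q) ((2 ℕ.+ q) ℕ.* c) ⟩
    x ^ (4 ℕ.+ q) * x ^ ((2 ℕ.+ q) ℕ.* c)                  ≡⟨ cong (x ^ (4 ℕ.+ q) *_) (sym (^-*-assoc x (2 ℕ.+ q) c)) ⟩
    x ^ (4 ℕ.+ q) * (x ^ (2 ℕ.+ q)) ^ c                    ∎
    where
    exponents : 4 ℕ.+ q ℕ.+ c ℕ.* q ℕ.+ 2 ℕ.* c ≡ 4 ℕ.+ q ℕ.+ (2 ℕ.+ q) ℕ.* c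
    exponents = trans (ℕₚ.+-assoc (4 ℕ.+ q) (c ℕ.* q) (2 ℕ.* c)) (cong (4 ℕ.+ q ℕ.+_)
      (trans (ℕₚ.+-comm (c ℕ.* q) (2 ℕ.* c)) (trans (cong (2 ℕ.* c ℕ.+_) (ℕₚ.*-comm c q)) (sym (ℕₚ.*-distribʳ-+ c 2 q)))))

  *-≢0 : ∀ {i j} → i ≢ + 0 → j ≢ + 0 → i * j ≢ + 0
  *-≢0 {i} i≢0 j≢0 h = [ i≢0 , j≢0 ]′ (i*j≡0⇒i≡0∨j≡0 i h)

  ^-≢0 : ∀ {i} k → i ≢ + 0 → i ^ k ≢ + 0
  ^-≢0 {i} k i≢0 h = i≢0 (i^n≡0⇒i≡0 i k h)

  -- Truncated subtraction encodes the exponent n + C(n,2) (n - 4): for n ≥ 4 the part with `4 ∸ n`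
  -- is zero, and for n = 3 the exponent becomes 3 + 0 - 3 = 0.
  formula : ℕ → ℤ
  formula n = ((- + 1) ^ ((n C 2) ∸ 1)) * (+ 2) ^ (((n C 2) ℕ.+ 1) ∸ n)
    * (+ n) ^ ((n ℕ.+ (n C 2) ℕ.* (n ∸ 4)) ∸ (n C 2) ℕ.* (4 ∸ n)) * (+ (n ∸ 2))

  module Evaluation (n p : ℕ) (n≡3+p : n ≡ 3 ℕ.+ p)
    (Ts : List (Subset (m n))) (Ts! : Unique Ts) (Ts-trees : ∀ T → (T List.∈ Ts) ⇔ SpanningTree n T) where
    open EdgeSums n using (E; ν)
    open Spectrum n using (G; det-G)

    private
      -- From C(n,2) = (n - 1) + C(n - 1,2): `D` is the exponent C(n,2) - n + 1 of two, and `s` is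
      -- the sign with exponent C(n,2) - 1.
      D = (2 ℕ.+ p) C 2
      s = (- + 1) ^ (suc p ℕ.+ D)

      n>0 : 0 ℕ.< n
      n>0 = subst (0 ℕ.<_) (sym n≡3+p) (s≤s z≤n)

      ν≢0 : ν ≢ + 0
      ν≢0 = Spectrum.ν≢0 n n>0

      E≡ : E ≡ 2 ℕ.+ p ℕ.+ D
      E≡ = trans (m≡nC2 n) (trans (cong (_C 2) n≡3+p) (nC2-suc (2 ℕ.+ p)))

    -- The minus sign in front of n - 2 lowers the exponent of -1 from E to E - 1 up to parity, and
    -- 2^(E+1) divided by 2^n leaves 2^D.
    det-G-closed : det E G ≡ s * (+ 2) ^ D * ν ^ n * + suc p
    det-G-closed = cancelˡ ((+ 2) ^ n) (^-≢0 n (λ ())) (begin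
      (+ 2) ^ n * det E G                                                     ≡⟨ det-G n>0 ⟩
      (- + 2) ^ E * ν ^ n * (- (+ 2 * (ν - + 2)))                             ≡⟨ cong₂ (λ a b → a * ν ^ n * (- (+ 2 * b))) power (cong (λ k → + k - + 2) n≡3+p) ⟩
      (- + 1) * s * ((+ 2) ^ (2 ℕ.+ p) * (+ 2) ^ D) * ν ^ n * (- (+ 2 * + suc p)) ≡⟨ shuffle s ((+ 2) ^ (2 ℕ.+ p)) ((+ 2) ^ D) (ν ^ n) (+ suc p) ⟩
      + 2 * (+ 2) ^ (2 ℕ.+ p) * (s * (+ 2) ^ D * ν ^ n * + suc p)             ≡⟨ cong (λ k → (+ 2) ^ k * (s * (+ 2) ^ D * ν ^ n * + suc p)) (sym n≡3+p) ⟩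
      (+ 2) ^ n * (s * (+ 2) ^ D * ν ^ n * + suc p)                           ∎)
      where
      shuffle : ∀ s a b w y → (- + 1) * s * (a * b) * w * (- (+ 2 * y)) ≡ + 2 * a * (s * b * w * y)
      shuffle = solve-∀
      power : (- + 2) ^ E ≡ (- + 1) * s * ((+ 2) ^ (2 ℕ.+ p) * (+ 2) ^ D)
      power = trans (cong ((- + 2) ^_) E≡) (trans ([-2]^ (2 ℕ.+ p ℕ.+ D)) (cong ((- + 1) * s *_) (^-distribˡ-+-* (+ 2) (2 ℕ.+ p) D)))

    -- The factor (n²)^E is what scaling all E rows of the Hessian by n² produces.
    formula-closed : formula n * (ν * ν) ^ E ≡ s * (+ 2) ^ D * + suc p * (ν ^ n * (ν ^ suc p) ^ E)
    formula-closed = begin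
      formula n * (ν * ν) ^ E
        ≡⟨ cong (_* (ν * ν) ^ E) (cong₂ (λ a b → a * ν ^ ex * b) (cong₂ (λ a b → (- + 1) ^ a * (+ 2) ^ b) sign-exponent two-exponent) (cong (λ k → + (k ∸ 2)) n≡3+p)) ⟩
      s * (+ 2) ^ D * ν ^ ex * + suc p * (ν * ν) ^ E
        ≡⟨ shuffle (s * (+ 2) ^ D) (ν ^ ex) (+ suc p) ((ν * ν) ^ E) ⟩
      s * (+ 2) ^ D * + suc p * (ν ^ ex * (ν * ν) ^ E)
        ≡⟨ cong (s * (+ 2) ^ D * + suc p *_) n-power ⟩
      s * (+ 2) ^ D * + suc p * (ν ^ n * (ν ^ suc p) ^ E) ∎
      where
      ex : ℕ
      ex = (n ℕ.+ (n C 2) ℕ.* (n ∸ 4)) ∸ (n C 2) ℕ.* (4 ∸ n)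
      shuffle : ∀ a b c d → a * b * c * d ≡ a * c * (b * d)
      shuffle = solve-∀
      C≡ : n C 2 ≡ 2 ℕ.+ p ℕ.+ D
      C≡ = trans (sym (m≡nC2 n)) E≡
      sign-exponent : (n C 2) ∸ 1 ≡ suc p ℕ.+ D
      sign-exponent = cong (_∸ 1) C≡
      two-exponent : ((n C 2) ℕ.+ 1) ∸ n ≡ D
      two-exponent = trans (cong₂ (λ a b → (a ℕ.+ 1) ∸ b) C≡ n≡3+p)
        (trans (cong (_∸ (3 ℕ.+ p)) (ℕₚ.+-comm (2 ℕ.+ p ℕ.+ D) 1)) (ℕₚ.m+n∸m≡n (3 ℕ.+ p) D))
      n-power : ν ^ ex * (ν * ν) ^ E ≡ ν ^ n * (ν ^ suc p) ^ E
      n-power = subst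
        (λ k → ν ^ ((k ℕ.+ (n C 2) ℕ.* (k ∸ 4)) ∸ (n C 2) ℕ.* (4 ∸ k)) * (ν * ν) ^ E ≡ ν ^ k * (ν ^ suc p) ^ E) (sym n≡3+p)
        (subst (λ c → ν ^ ((3 ℕ.+ p ℕ.+ c ℕ.* (3 ℕ.+ p ∸ 4)) ∸ c ℕ.* (4 ∸ (3 ℕ.+ p))) * (ν * ν) ^ E ≡ ν ^ (3 ℕ.+ p) * (ν ^ suc p) ^ E) (m≡nC2 n)
          (^-exponent p E ν (λ p≡0 → trans E≡ (cong (λ q → 2 ℕ.+ q ℕ.+ (2 ℕ.+ q) C 2) p≡0))))

    det-hessian1 : det E (hessian1 n Ts) ≡ formula n
    det-hessian1 = cancelˡ ((ν * ν) ^ E) (^-≢0 E (*-≢0 ν≢0 ν≢0)) (begin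
      (ν * ν) ^ E * det E (hessian1 n Ts)                       ≡⟨ sym (det-scale E (ν * ν) (hessian1 n Ts)) ⟩
      det E (λ e f → ν * ν * hessian1 n Ts e f)                 ≡⟨ det-cong E (TwoEdges.hessian1-entry n p n≡3+p Ts Ts! Ts-trees) ⟩
      det E (λ e f → ν ^ suc p * G e f)                         ≡⟨ det-scale E (ν ^ suc p) G ⟩
      (ν ^ suc p) ^ E * det E G                                 ≡⟨ cong ((ν ^ suc p) ^ E *_) det-G-closed ⟩
      (ν ^ suc p) ^ E * (s * (+ 2) ^ D * ν ^ n * + suc p)       ≡⟨ shuffle ((ν ^ suc p) ^ E) (s * (+ 2) ^ D) (ν ^ n) (+ suc p) ⟩
      s * (+ 2) ^ D * + suc p * (ν ^ n * (ν ^ suc p) ^ E)       ≡⟨ sym formula-closed ⟩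
      formula n * (ν * ν) ^ E                                   ≡⟨ *-comm (formula n) ((ν * ν) ^ E) ⟩
      (ν * ν) ^ E * formula n                                   ∎)
      where
      shuffle : ∀ a b c d → a * (b * c * d) ≡ b * d * (c * a)
      shuffle = solve-∀

    -- All bases of the powers are nonzero, and n - 2 = p + 1 is positive.
    formula≢0 : formula n ≢ + 0
    formula≢0 = *-≢0 (*-≢0 (*-≢0 (^-≢0 ((n C 2) ∸ 1) (λ ())) (^-≢0 (((n C 2) ℕ.+ 1) ∸ n) (λ ())))
      (^-≢0 ((n ℕ.+ (n C 2) ℕ.* (n ∸ 4)) ∸ (n C 2) ℕ.* (4 ∸ n)) ν≢0))
      (λ h → suc≢0 (trans (sym (cong (λ k → + (k ∸ 2)) n≡3+p)) h))
      where
      suc≢0 : + suc p ≢ + 0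
      suc≢0 ()

open import Data.Nat using (_≤_; _∸_; _*_; _+_)
open import Data.List.Membership.Propositional using (_∈_)

theorem3p4 : (n : ℕ) → 3 ≤ n →
    (Ts : List (Subset (m n))) → Unique Ts → (∀ T → (T ∈ Ts) ⇔ SpanningTree n T) →
    (det (m n) (hessian1 n Ts)
    ≡ ((- + 1) ℤ.^ ((n C 2) ∸ 1)) ℤ.* (+ 2) ℤ.^ (((n C 2) + 1) ∸ n)
    ℤ.* (+ n) ℤ.^ ((n + (n C 2) * (n ∸ 4)) ∸ (n C 2) * (4 ∸ n))
    ℤ.* (+ (n ∸ 2)))
    × ¬ (∀ (x : Fin (m n) → ℤ) → det (m n) (hessian n Ts x) ≡ + 0)
-- A Hessian that vanished at every integer point would vanish at the all-ones point, where its
-- value is the nonzero `formula n`.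
theorem3p4 n 3≤n Ts Ts! Ts-trees = det-hessian1 , λ h → formula≢0 (trans (sym det-hessian1) (h (λ _ → + 1)))
  where open HessianDeterminant.Evaluation n (n ∸ 3) (sym (ℕₚ.m+[n∸m]≡n 3≤n)) Ts Ts! Ts-trees
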